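{- Let $p \geq 5$ be a prime number. Then, for any Mersenne prime $M \in \mathbb{F}_2[x]$ with $M \notin \Sigma_p$, the polynomial $\phi_p(M) = 1 + M + \cdots + M^{p-1} = \sigma(M^{p-1})$ is divisible by a non Mersenne prime, i.e. by an irreducible polynomial of $\mathbb{F}_2[x]$ that is not a Mersenne prime.
   Context: A Mersenne prime (polynomial) over $\mathbb{F}_2$ is an irreducible polynomial in $\mathbb{F}_2[x]$ of the form $1 + x^a(x+1)^b$ with $a, b$ positive integers. For a nonzero $A \in \mathbb{F}_2[x]$, $\sigma(A) \in \mathbb{F}_2[x]$ denotes the sum of all divisors of $A$ in $\mathbb{F}_2[x]$. $\phi_p$ is the $p$-th cyclotomic polynomial (reduced mod 2). For a nonzero $S \in \mathbb{F}_2[x]$ of degree $s$ and $0 \le l \le s$, $\alpha_l(S)$ denotes the coefficient of $x^{s-l}$ in $S$ (so $\alpha_0(S) = 1$). Given a prime $p = 2h+1 \ge 5$ and a Mersenne prime $M = 1 + x^a(x+1)^b$, set - $\deg_M := \deg(M) = a+b$, - $U_{2h} := \sigma(\sigma(M^{2h}))$, - $W_M := U_{2h} + \sigma(M^{2h}) + 1$, - $c_M := 2h\deg_M - \deg(W_M)$ (for $W_M \neq 0$), - $m_M$ := the least odd integer $m \ge 1$ such that $\alpha_m(W_M) = 1$, considered when $\deg(W_M)$ is even (equivalently, when $c_M$ is even) and such an $m$ exists. A Mersenne prime $M$ for which a quantity appearing in a condition below is undefined does not satisfy that condition. Define the following sets of Mersenne primes: $\Sigma_p^1 := \{M : c_M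 = \deg_M\}$, $\Sigma_p^2 := \{M : c_M = \deg_M + 1,\ c_M \text{ odd}\}$, $\Sigma_p^3 := \{M : c_M + m_M = \deg_M,\ c_M \text{ even}\}$, $\Sigma_p^4 := \{M : c_M + m_M = \deg_M + 1,\ c_M \text{ even and } m_M \ge 3\}$, and $\Sigma_p := \Sigma_p^1 \cup \Sigma_p^2 \cup \Sigma_p^3 \cup \Sigma_p^4$. -}

module Defs where

open import Algebra.Bundles using (CommutativeRing; RawRing)
open import Algebra.Definitions.RawMagma using (module _∣ʳ_)
import Algebra.Definitions.RawSemiring as RawSemiringDefs
open import Data.Integer as ℤ using (ℤ; +_; _⊖_)
import Data.Integer.Divisibility as ℤ∣
import Data.Integer.Properties as ℤₚ
open import Data.List using (List; []; _∷_; _++_; map; filter; foldr; length)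
open import Data.List.Membership.Propositional using (_∈_; lose)
open import Data.List.Membership.Propositional.Properties using (∈-++⁺ˡ; ∈-++⁺ʳ; ∈-map⁺)
open import Data.List.Relation.Unary.Any using (any?; here; satisfied)
open import Data.Nat as ℕ using (ℕ; zero; suc; _∸_; _<_; _≤_; _≥_; ⌊_/2⌋; z≤n; s≤s)
open import Data.Nat.Divisibility as ℕ∣ using ()
import Data.Nat.Properties as ℕₚ
open import Data.Parity as ℙ using (Parity; 0ℙ; 1ℙ)
import Data.Parity.Properties as ℙₚ
open import Data.Product using (∃; ∃₂; _×_; _,_; proj₁; proj₂)
open import Level using (0ℓ)
open import Relation.Binary.Definitions using (Decidable)
open import Relation.Binary.PropositionalEquality
  using (_≡_; refl; sym; trans; cong; cong₂; subst)
open import Relation.Nullary using (¬_; Dec; yes; no; contradiction)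
open import Relation.Nullary.Decidable using (map′; _×-dec_)
open import Relation.Unary using (Pred; _∪_)

-- Univariate polynomials: coefficient lists, constant term first, trailing
-- zeros allowed; equality is equality of all coefficients.
module Polynomial {c ℓ} (R : CommutativeRing c ℓ)
                  (_≟_ : Decidable (CommutativeRing._≈_ R)) where

  private module R = CommutativeRing R

  Poly : Set c
  Poly = List R.Carrier

  coeff : Poly → ℕ → R.Carrier
  coeff []      n       = R.0#
  coeff (a ∷ f) zero    = a
  coeff (a ∷ f) (suc n) = coeff f n

  infix 4 _≈_ _≈?_

  record _≈_ (f g : Poly) : Set ℓ where
    constructor coeffwise
    field coeff-≈ : ∀ n → coeff f n R.≈ coeff g n

  open _≈_ public

  infixl 6 _+_ _-_
  infixl 7 _*_ _·_
  infix  8 -_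

  _+_ : Poly → Poly → Poly
  []      + g       = g
  (a ∷ f) + []      = a ∷ f
  (a ∷ f) + (b ∷ g) = (a R.+ b) ∷ (f + g)

  -_ : Poly → Poly
  -_ = map (λ a → R.- a)

  _-_ : Poly → Poly → Poly
  f - g = f + (- g)

  _·_ : R.Carrier → Poly → Poly
  a · f = map (a R.*_) f

  _*_ : Poly → Poly → Poly
  []      * g = []
  (a ∷ f) * g = a · g + (R.0# ∷ f * g)

  const : R.Carrier → Poly
  const a = a ∷ []

  0# 1# X : Poly
  0# = []
  1# = const R.1#
  X  = R.0# ∷ R.1# ∷ []

  rawRing : RawRing c ℓ
  rawRing = record
    { Carrier = Poly
    ; _≈_ = _≈_
    ; _+_ = _+_
    ; _*_ = _*_
    ; -_  = -_
    ; 0#  = 0#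
    ; 1#  = 1#
    }

  open RawRing rawRing public using (_≉_)
  open RawSemiringDefs (RawRing.rawSemiring rawRing) public
    using (_∣_; _∤_; _^_; Irreducible; mkIrred)
    renaming (sum to ∑)

  ∑ₗ ∏ₗ : List Poly → Poly
  ∑ₗ = foldr _+_ 0#
  ∏ₗ = foldr _*_ 1#

  -- f ⟨ g ⟩ is the value f(g) of f at the polynomial g.
  infix 9 _⟨_⟩
  _⟨_⟩ : Poly → Poly → Poly
  []      ⟨ g ⟩ = 0#
  (a ∷ f) ⟨ g ⟩ = const a + g * f ⟨ g ⟩

  _≈?_ : Decidable _≈_
  [] ≈? [] = yes (coeffwise λ _ → R.refl)
  [] ≈? (b ∷ g) = map′
    (λ (p , q) → coeffwise λ { zero → p ; (suc n) → coeff-≈ q n })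
    (λ p → coeff-≈ p 0 , coeffwise λ n → coeff-≈ p (suc n))
    ((R.0# ≟ b) ×-dec ([] ≈? g))
  (a ∷ f) ≈? [] = map′
    (λ (p , q) → coeffwise λ { zero → p ; (suc n) → coeff-≈ q n })
    (λ p → coeff-≈ p 0 , coeffwise λ n → coeff-≈ p (suc n))
    ((a ≟ R.0#) ×-dec (f ≈? []))
  (a ∷ f) ≈? (b ∷ g) = map′
    (λ (p , q) → coeffwise λ { zero → p ; (suc n) → coeff-≈ q n })
    (λ p → coeff-≈ p 0 , coeffwise λ n → coeff-≈ p (suc n))
    ((a ≟ b) ×-dec (f ≈? g))

  -- The zero polynomial gets the junk value 0.
  degree : Poly → ℕ
  degree []      = 0
  degree (a ∷ f) with f ≈? 0#
  ... | yes _ = 0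
  ... | no  _ = suc (degree f)

  -- Long division, returning (quotient , remainder).
  -- Meaningful only for a monic divisor g.
  divMod : Poly → Poly → Poly × Poly
  divMod []      g = 0# , 0#
  divMod (a ∷ f) g =
    let (q , r) = divMod f g
        s       = a ∷ r
        b       = coeff s (degree g)
    in  (b ∷ q) , (s - b · g)

  _/ₘ_ : Poly → Poly → Poly
  f /ₘ g = proj₁ (divMod f g)

module ℤ[x] = Polynomial ℤₚ.+-*-commutativeRing ℤ._≟_

-- Parity, with its stdlib ring structure, is the field with two elements.
open Polynomial ℙₚ.+-*-commutativeRing ℙₚ._≟_ public

𝔽₂[x] : Set
𝔽₂[x] = Poly

-- Cyclotomic polynomials over ℤ, by  xⁿ - 1 = ∏_{d ∣ n} Φ_d ;
-- cyclotomics≤ n lists the pairs (d , Φ_d) for 1 ≤ d ≤ n.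
cyclotomic : ℕ → ℤ[x].Poly
cyclotomics≤ : ℕ → List (ℕ × ℤ[x].Poly)

cyclotomic zero    = ℤ[x].1#
cyclotomic (suc n) =
  (ℤ[x].X ℤ[x].^ suc n ℤ[x].- ℤ[x].1#) ℤ[x]./ₘ
  ℤ[x].∏ₗ (map proj₂ (filter (λ (d , _) → d ℕ∣.∣? suc n) (cyclotomics≤ n)))

cyclotomics≤ zero    = []
cyclotomics≤ (suc n) = (suc n , cyclotomic (suc n)) ∷ cyclotomics≤ n

reduce : ℤ[x].Poly → 𝔽₂[x]
reduce = map (λ z → ℕ.parity ℤ.∣ z ∣)

φ : ℕ → 𝔽₂[x]
φ n = reduce (cyclotomic n)

-- Every polynomial of degree < n, exactly once (padded to length n).
polys< : ℕ → List 𝔽₂[x]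
polys< zero    = [] ∷ []
polys< (suc n) = map (0ℙ ∷_) (polys< n) ++ map (1ℙ ∷_) (polys< n)

pad : ℕ → 𝔽₂[x] → 𝔽₂[x]
pad zero    f       = []
pad (suc n) []      = 0ℙ ∷ pad n []
pad (suc n) (a ∷ f) = a ∷ pad n f

pad∈polys< : ∀ n f → pad n f ∈ polys< n
pad∈polys< zero    f        = here refl
pad∈polys< (suc n) []       = ∈-++⁺ˡ (∈-map⁺ _ (pad∈polys< n []))
pad∈polys< (suc n) (0ℙ ∷ f) = ∈-++⁺ˡ (∈-map⁺ _ (pad∈polys< n f))
pad∈polys< (suc n) (1ℙ ∷ f) =
  ∈-++⁺ʳ (map (0ℙ ∷_) (polys< n)) (∈-map⁺ _ (pad∈polys< n f))

coeff-pad : ∀ n f → (∀ m → n ≤ m → coeff f m ≡ 0ℙ) → pad n f ≈ f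
coeff-pad n f v = coeffwise (go n f v)
  where
  go : ∀ n f → (∀ m → n ≤ m → coeff f m ≡ 0ℙ) → ∀ k → coeff (pad n f) k ≡ coeff f k
  go zero    f       v k       = sym (v k z≤n)
  go (suc n) []      v zero    = refl
  go (suc n) []      v (suc k) = go n [] (λ _ _ → refl) k
  go (suc n) (a ∷ f) v zero    = refl
  go (suc n) (a ∷ f) v (suc k) = go n f (λ m p → v (suc m) (s≤s p)) k

coeff-+ : ∀ f g n → coeff (f + g) n ≡ coeff f n ℙ.+ coeff g n
coeff-+ []      g       n       = refl
coeff-+ (a ∷ f) []      n       = sym (ℙₚ.+-identityʳ _)
coeff-+ (a ∷ f) (b ∷ g) zero    = refl
coeff-+ (a ∷ f) (b ∷ g) (suc n) = coeff-+ f g n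

coeff-· : ∀ a f n → coeff (a · f) n ≡ a ℙ.* coeff f n
coeff-· a []      n       = sym (ℙₚ.*-zeroʳ a)
coeff-· a (b ∷ f) zero    = refl
coeff-· a (b ∷ f) (suc n) = coeff-· a f n

coeff-∷* : ∀ a f g n →
  coeff ((a ∷ f) * g) n ≡ a ℙ.* coeff g n ℙ.+ coeff (0ℙ ∷ f * g) n
coeff-∷* a f g n = trans (coeff-+ (a · g) (0ℙ ∷ f * g) n)
  (cong (ℙ._+ coeff (0ℙ ∷ f * g) n) (coeff-· a g n))

*-vanishˡ : ∀ f g → (∀ n → coeff f n ≡ 0ℙ) → ∀ n → coeff (f * g) n ≡ 0ℙ
*-vanishˡ []      g v n    = refl
*-vanishˡ (a ∷ f) g v zero =
  trans (coeff-∷* a f g 0) (cong (λ z → z ℙ.* coeff g 0 ℙ.+ 0ℙ) (v 0))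
*-vanishˡ (a ∷ f) g v (suc n) = trans (coeff-∷* a f g (suc n))
  (cong₂ (λ z w → z ℙ.* coeff g (suc n) ℙ.+ w) (v 0)
    (*-vanishˡ f g (λ m → v (suc m)) n))

*-vanishʳ : ∀ f g → (∀ n → coeff g n ≡ 0ℙ) → ∀ n → coeff (f * g) n ≡ 0ℙ
*-vanishʳ []      g v n    = refl
*-vanishʳ (a ∷ f) g v zero = trans (coeff-∷* a f g 0)
  (trans (cong (λ z → a ℙ.* z ℙ.+ 0ℙ) (v 0)) (cong (ℙ._+ 0ℙ) (ℙₚ.*-zeroʳ a)))
*-vanishʳ (a ∷ f) g v (suc n) = trans (coeff-∷* a f g (suc n))
  (trans (cong₂ (λ z w → a ℙ.* z ℙ.+ w) (v (suc n)) (*-vanishʳ f g v n))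
    (cong (ℙ._+ 0ℙ) (ℙₚ.*-zeroʳ a)))

*-congˡ : ∀ {f f′} g → f ≈ f′ → f * g ≈ f′ * g
*-congˡ {f} {f′} g p = coeffwise (go f f′ (coeff-≈ p))
  where
  go : ∀ f f′ → (∀ n → coeff f n ≡ coeff f′ n) → ∀ n → coeff (f * g) n ≡ coeff (f′ * g) n
  go []      f′       e n       = sym (*-vanishˡ f′ g (λ m → sym (e m)) n)
  go (a ∷ f) []       e n       = *-vanishˡ (a ∷ f) g e n
  go (a ∷ f) (b ∷ f′) e zero    = trans (coeff-∷* a f g 0)
    (trans (cong (λ z → z ℙ.* coeff g 0 ℙ.+ 0ℙ) (e 0)) (sym (coeff-∷* b f′ g 0)))
  go (a ∷ f) (b ∷ f′) e (suc n) = trans (coeff-∷* a f g (suc n))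
    (trans (cong₂ (λ z w → z ℙ.* coeff g (suc n) ℙ.+ w) (e 0)
             (go f f′ (λ m → e (suc m)) n))
      (sym (coeff-∷* b f′ g (suc n))))

coeff-*-top : ∀ f g m n →
  (∀ k → m < k → coeff f k ≡ 0ℙ) → (∀ k → n < k → coeff g k ≡ 0ℙ) →
  coeff (f * g) (m ℕ.+ n) ≡ coeff f m ℙ.* coeff g n
coeff-*-top []      g m       n vf vg = refl
coeff-*-top (a ∷ f) g zero    n vf vg = trans (coeff-∷* a f g n)
  (trans (cong (a ℙ.* coeff g n ℙ.+_) (tail n)) (ℙₚ.+-identityʳ _))
  where
  tail : ∀ k → coeff (0ℙ ∷ f * g) k ≡ 0ℙ
  tail zero    = refl
  tail (suc k) = *-vanishˡ f g (λ j → vf (suc j) (s≤s z≤n)) k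
coeff-*-top (a ∷ f) g (suc m) n vf vg = trans (coeff-∷* a f g (suc (m ℕ.+ n)))
  (trans (cong (λ z → a ℙ.* z ℙ.+ coeff (f * g) (m ℕ.+ n))
           (vg _ (s≤s (ℕₚ.m≤n+m n m))))
  (trans (cong (ℙ._+ coeff (f * g) (m ℕ.+ n)) (ℙₚ.*-zeroʳ a))
    (coeff-*-top f g m n (λ k p → vf (suc k) (s≤s p)) vg)))

coeff-degree : ∀ f → f ≉ 0# → coeff f (degree f) ≡ 1ℙ
coeff-degree []      f≉0 = contradiction (coeffwise λ _ → refl) f≉0
coeff-degree (a ∷ f) f≉0 with f ≈? 0#
coeff-degree (a  ∷ f) f≉0 | no  q = coeff-degree f q
coeff-degree (1ℙ ∷ f) f≉0 | yes q = refl
coeff-degree (0ℙ ∷ f) f≉0 | yes q =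
  contradiction (coeffwise λ { zero → refl ; (suc n) → coeff-≈ q n }) f≉0

coeff>degree : ∀ f k → degree f < k → coeff f k ≡ 0ℙ
coeff>degree []      k       p = refl
coeff>degree (a ∷ f) (suc k) p with f ≈? 0#
coeff>degree (a ∷ f) (suc k) p       | yes q = coeff-≈ q k
coeff>degree (a ∷ f) (suc k) (s≤s p) | no  _ = coeff>degree f k p

coeff≥length : ∀ f n → length f ≤ n → coeff f n ≡ 0ℙ
coeff≥length []      n       p       = refl
coeff≥length (a ∷ f) (suc n) (s≤s p) = coeff≥length f n p

quotient-bound : ∀ f g h → h ≉ 0# → f * g ≈ h →
  ∀ m → length h ≤ m → coeff f m ≡ 0ℙ
quotient-bound f g h h≉0 e m l≤m with f ≈? 0# | g ≈? 0#
... | yes f≈0 | _ = coeff-≈ f≈0 m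
... | no _ | yes g≈0 = contradiction
  (coeffwise λ n → trans (sym (coeff-≈ e n)) (*-vanishʳ f g (coeff-≈ g≈0) n)) h≉0
... | no f≉0 | no g≉0 = coeff>degree f m (ℕₚ.<-≤-trans deg< l≤m)
  where
  top : coeff h (degree f ℕ.+ degree g) ≡ 1ℙ
  top = trans (sym (coeff-≈ e _))
    (trans (coeff-*-top f g _ _ (coeff>degree f) (coeff>degree g))
      (cong₂ ℙ._*_ (coeff-degree f f≉0) (coeff-degree g g≉0)))

  deg< : degree f < length h
  deg< with degree f ℕ.<? length h
  ... | yes p = p
  ... | no ¬p with () ← trans (sym top)
    (coeff≥length h _ (ℕₚ.≤-trans (ℕₚ.≮⇒≥ ¬p) (ℕₚ.m≤m+n _ (degree g))))

infix 4 _∣?_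

_∣?_ : Decidable _∣_
g ∣? h with h ≈? 0#
... | yes h≈0 = yes (record { quotient = 0# ; equality = coeffwise λ n → sym (coeff-≈ h≈0 n) })
... | no  h≉0 = map′
  (λ a → let (q , e) = satisfied a in record { quotient = q ; equality = e })
  search
  (any? (λ q → q * g ≈? h) (polys< (length h)))
  where
  search : g ∣ h → _
  search d = lose (pad∈polys< (length h) q) (coeffwise λ n →
    trans (coeff-≈ (*-congˡ g (coeff-pad (length h) q (quotient-bound q g h h≉0 eq))) n)
          (coeff-≈ eq n))
    where
    q  = _∣ʳ_.quotient d
    eq = _∣ʳ_.equality d

-- The sum of all divisors of A ≠ 0 (each divisor has degree < length A).
σ : 𝔽₂[x] → 𝔽₂[x]
σ A = ∑ₗ (filter (_∣? A) (polys< (length A)))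

MersennePrime : Pred 𝔽₂[x] 0ℓ
MersennePrime M = Irreducible M ×
  ∃₂ λ a b → a ≥ 1 × b ≥ 1 × M ≈ 1# + X ^ a * (X + 1#) ^ b

-- The coefficient of x^(s - l) in S, s = degree S; used for S ≠ 0 and l ≤ s.
α : ℕ → 𝔽₂[x] → Parity
α l S = coeff S (degree S ∸ l)

Odd : ℕ → Set
Odd m = ¬ (2 ℕ∣.∣ m)

module _ (h : ℕ) (M : 𝔽₂[x]) where

  U W : 𝔽₂[x]
  U = σ (σ (M ^ (2 ℕ.* h)))
  W = U + σ (M ^ (2 ℕ.* h)) + 1#

  -- _⊖_ is the integer difference of two naturals.
  c : ℤ
  c = (2 ℕ.* h ℕ.* degree M) ⊖ degree W

  OddOneAt : Pred ℕ 0ℓ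
  OddOneAt m = Odd m × m ≤ degree W × α m W ≡ 1ℙ

  -- m is the value of m_M.
  IsLeastOddOne : Pred ℕ 0ℓ
  IsLeastOddOne m = OddOneAt m × (∀ k → OddOneAt k → m ≤ k)

-- The sets Σ_p^i for p = 2h + 1.  The condition W ≉ 0# says that c is defined.
module _ (p : ℕ) where

  private
    h : ℕ
    h = ⌊ p /2⌋

    cEven : Pred 𝔽₂[x] 0ℓ
    cEven M = + 2 ℤ∣.∣ c h M

  Σ¹ Σ² Σ³ Σ⁴ Σₚ : Pred 𝔽₂[x] 0ℓ

  Σ¹ M = MersennePrime M × W h M ≉ 0# × c h M ≡ + degree M

  Σ² M = MersennePrime M × W h M ≉ 0# × c h M ≡ + (degree M ℕ.+ 1) × ¬ cEven M

  Σ³ M = MersennePrime M × W h M ≉ 0# × cEven M ×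
    ∃ λ m → IsLeastOddOne h M m × c h M ℤ.+ + m ≡ + degree M

  Σ⁴ M = MersennePrime M × W h M ≉ 0# × cEven M ×
    ∃ λ m → IsLeastOddOne h M m × c h M ℤ.+ + m ≡ + (degree M ℕ.+ 1) × m ≥ 3

  Σₚ = Σ¹ ∪ Σ² ∪ Σ³ ∪ Σ⁴

{-# OPTIONS --safe #-}

-- Suppose that all irreducible factors of F = σ(M²ʰ) = 1 + M + ⋯ + M²ʰ are
-- Mersenne primes Mⱼ.  They occur to the first power, so σ F = ∏ (1 + Mⱼ) is of
-- the form xᵘ(x+1)ᵛ; since Mⱼ and 1 + Mⱼ have the same two top coefficients, so
-- have F and σ F.  The second one is 0 for F, which forces u and v to be even:
-- σ F = S².
-- In characteristic 2, M = A² + x Q² with Q = xⁱ(x+1)ʲ.  Up to degree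
-- (2h-2) deg M, which is too low to matter,
--   W = S² + (Mʰ)² + M (Mʰ⁻¹)² = (S + Mʰ + A Mʰ⁻¹)² + x (Q Mʰ⁻¹)²,
-- so the highest odd index carrying a coefficient 1 of W is 2h deg M - e, where
-- e = deg M if deg M is odd and e = deg M + 1 if it is even.  If deg W is odd,
-- then c = e; if deg W is even, then c + m = e.  Either way M ∈ Σₚ.
module Submission where

open import Defs
open import Algebra.Bundles using (CommutativeMonoid; CommutativeRing)
open import Algebra.Definitions.RawMagma using (_,_)
import Algebra.Properties.CommutativeSemigroup as CommutativeSemigroupₚ
import Algebra.Properties.CommutativeSemigroup.Divisibility as SemigroupDivisibility
import Algebra.Properties.Group as Groupₚ
import Algebra.Properties.Semiring.Divisibility as SemiringDivisibility
import Algebra.Properties.Semiring.Exp as Exp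
import Algebra.Properties.Semiring.Primality as Primality
import Algebra.Properties.Semiring.Sum as Sumₚ
import Algebra.Solver.Ring as RingSolver
open import Algebra.Solver.Ring.AlmostCommutativeRing
  using (fromCommutativeRing; _-Raw-AlmostCommutative⟶_)
open import Data.Fin using (toℕ)
open import Data.Integer as ℤ using (ℤ; +_; _⊖_)
import Data.Integer.Properties as ℤₚ
open import Data.List using (List; []; _∷_; _++_; drop; filter; length; map; replicate)
open import Data.List.Properties using (filter-accept; filter-reject)
import Data.List.Membership.Setoid as Membership
import Data.List.Membership.Setoid.Properties as ∈ₚ
open import Data.List.Relation.Binary.Disjoint.Setoid using (Disjoint)
open import Data.List.Relation.Unary.All as All using ([]; _∷_)
import Data.List.Relation.Unary.All.Properties as Allₚ
open import Data.List.Relation.Unary.AllPairs using ([]; _∷_)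
open import Data.List.Relation.Unary.Any as Any using (any?; here; there)
import Data.List.Relation.Unary.Unique.Setoid as UniqueSetoid
import Data.List.Relation.Unary.Unique.Setoid.Properties as Uniqueₚ
open import Data.Maybe using (Maybe)
open import Data.Nat as ℕ
  using (ℕ; zero; suc; _≤_; _<_; _≥_; _∸_; ⌊_/2⌋; z≤n; s≤s; z<s)
open import Data.Nat.Divisibility as ℕ∣ using ()
open import Data.Nat.Primality using (Prime; prime⇒irreducible)
import Data.Nat.Properties as ℕₚ
open import Data.Nat.Solver using (module +-*-Solver)
open import Data.Parity as ℙ using (0ℙ; 1ℙ)
import Data.Parity.Properties as ℙₚ
open import Data.Product using (∃; ∃₂; _×_; _,_; proj₁; proj₂)
open import Data.Sum as Sum using (_⊎_; inj₁; inj₂; [_,_]′)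
open import Function using (_∘_; id)
open import Level using (0ℓ)
open import Relation.Binary.Definitions using (tri<; tri≈; tri>)
open import Relation.Binary.PropositionalEquality as ≡
  using (_≡_; refl; cong; cong₂; subst)
import Relation.Binary.Reasoning.Setoid as SetoidReasoning
open import Relation.Nullary using (¬_; Dec; yes; no; contradiction)
open import Relation.Nullary.Decidable using (_×-dec_; ¬?; dec⇒maybe; map′)
open import Relation.Unary using (_∉_)

-- The ring 𝔽₂[x]

-- No derivative is defined. Its role is taken by the unique decomposition `A * A + X * (B * B)`,
-- where `B` is the square root of the derivative: it serves for simple factors, for deciding when
-- `split u v` is a square, and for the top odd coefficient of `W`. Factors are simple because
-- `(1# + M) * F` is `1# + M ^ (2h+1)`, whose odd part is `M ^ h * Q`. A double factor would divide
-- this, but it divides neither `M` nor, having degree at least 2, the product `Q` of powers of `x`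
-- and `x + 1`. Simplicity comes first because σ is multiplicative only on coprime factors. That `Q`
-- is nonzero rests on irreducibility: with both exponents even, `M` would be a square. The top
-- coefficients are compared in order to make σ F a square: squares have no odd coefficients, so the
-- unknown exponents `u` and `v` disappear from the odd part of `W`.

∷-cong : ∀ {a b f g} → a ≡ b → f ≈ g → (a ∷ f) ≈ (b ∷ g)
∷-cong p q = coeffwise λ { zero → p ; (suc n) → coeff-≈ q n }

-- `const 0ℙ` and `0#` are different lists; the solver's `con 0ℙ` denotes the first.
0∷0≈0 : (0ℙ ∷ []) ≈ 0#
0∷0≈0 = coeffwise λ { zero → refl ; (suc n) → refl }

+-commutativeMonoid : CommutativeMonoid 0ℓ 0ℓ
+-commutativeMonoid = record
  { _≈_ = _≈_
  ; _∙_ = _+_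
  ; ε   = 0#
  ; isCommutativeMonoid = record
    { isMonoid = record
      { isSemigroup = record
        { isMagma = record
          { isEquivalence = record
            { refl  = coeffwise λ _ → refl
            ; sym   = λ p → coeffwise λ n → ≡.sym (coeff-≈ p n)
            ; trans = λ p q → coeffwise λ n → ≡.trans (coeff-≈ p n) (coeff-≈ q n)
            }
          ; ∙-cong = λ {f} {f′} {g} {g′} p q → coeffwise λ n →
              ≡.trans (coeff-+ f g n)
                (≡.trans (cong₂ ℙ._+_ (coeff-≈ p n) (coeff-≈ q n))
                  (≡.sym (coeff-+ f′ g′ n)))
          }
        ; assoc = λ f g h → coeffwise (assoc f g h)
        }
      ; identity = (λ _ → coeffwise λ _ → refl)
                 , (λ f → coeffwise λ n → ≡.trans (coeff-+ f 0# n) (ℙₚ.+-identityʳ _))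
      }
    ; comm = λ f g → coeffwise λ n →
        ≡.trans (coeff-+ f g n) (≡.trans (ℙₚ.+-comm (coeff f n) _) (≡.sym (coeff-+ g f n)))
    }
  }
  where
  assoc : ∀ f g h n → coeff (f + g + h) n ≡ coeff (f + (g + h)) n
  assoc f g h n rewrite coeff-+ (f + g) h n | coeff-+ f g n
                      | coeff-+ f (g + h) n | coeff-+ g h n =
    ℙₚ.+-assoc (coeff f n) _ _

private
  module +ₘ = CommutativeMonoid +-commutativeMonoid

open SetoidReasoning +ₘ.setoid
open CommutativeSemigroupₚ +ₘ.commutativeSemigroup using (interchange; x∙yz≈y∙xz)

·-distribˡ-+ : ∀ a f g → a · (f + g) ≈ a · f + a · g
·-distribˡ-+ a f g = coeffwise go
  where
  go : ∀ n → coeff (a · (f + g)) n ≡ coeff (a · f + a · g) n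
  go n rewrite coeff-· a (f + g) n | coeff-+ f g n | coeff-+ (a · f) (a · g) n
             | coeff-· a f n | coeff-· a g n = ℙₚ.*-distribˡ-+ a _ _

·-assoc : ∀ a b f → (a ℙ.* b) · f ≈ a · (b · f)
·-assoc a b f = coeffwise go
  where
  go : ∀ n → coeff ((a ℙ.* b) · f) n ≡ coeff (a · (b · f)) n
  go n rewrite coeff-· (a ℙ.* b) f n | coeff-· a (b · f) n | coeff-· b f n = ℙₚ.*-assoc a b _

0·f≈0 : ∀ f → 0ℙ · f ≈ 0#
0·f≈0 f = coeffwise (coeff-· 0ℙ f)

1·f≈f : ∀ f → 1ℙ · f ≈ f
1·f≈f f = coeffwise (coeff-· 1ℙ f)

*-zeroʳ : ∀ f → f * 0# ≈ 0#
*-zeroʳ f = coeffwise (*-vanishʳ f 0# λ _ → refl)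

*-distribˡ-+ : ∀ f g h → f * (g + h) ≈ f * g + f * h
*-distribˡ-+ []      g h = +ₘ.refl
*-distribˡ-+ (a ∷ f) g h = begin
  a · (g + h) + (0ℙ ∷ f * (g + h))
    ≈⟨ +ₘ.∙-cong (·-distribˡ-+ a g h) (∷-cong refl (*-distribˡ-+ f g h)) ⟩
  (a · g + a · h) + ((0ℙ ∷ f * g) + (0ℙ ∷ f * h))
    ≈⟨ interchange (a · g) (a · h) _ _ ⟩
  (a ∷ f) * g + (a ∷ f) * h ∎

*-∷ : ∀ f b g → f * (b ∷ g) ≈ b · f + (0ℙ ∷ f * g)
*-∷ []      b g = +ₘ.sym 0∷0≈0
*-∷ (a ∷ f) b g = ∷-cong (cong (ℙ._+ 0ℙ) (ℙₚ.*-comm a b)) (begin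
  a · g + f * (b ∷ g)              ≈⟨ +ₘ.∙-congˡ (*-∷ f b g) ⟩
  a · g + (b · f + (0ℙ ∷ f * g))   ≈⟨ x∙yz≈y∙xz (a · g) (b · f) _ ⟩
  b · f + (a ∷ f) * g              ∎)

*-comm : ∀ f g → f * g ≈ g * f
*-comm []      g = +ₘ.sym (*-zeroʳ g)
*-comm (a ∷ f) g = begin
  a · g + (0ℙ ∷ f * g)  ≈⟨ +ₘ.∙-congˡ (∷-cong refl (*-comm f g)) ⟩
  a · g + (0ℙ ∷ g * f)  ≈⟨ *-∷ g a f ⟨
  g * (a ∷ f)           ∎

*-distribʳ-+ : ∀ h f g → (f + g) * h ≈ f * h + g * h
*-distribʳ-+ h f g = begin
  (f + g) * h    ≈⟨ *-comm (f + g) h ⟩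
  h * (f + g)    ≈⟨ *-distribˡ-+ h f g ⟩
  h * f + h * g  ≈⟨ +ₘ.∙-cong (*-comm h f) (*-comm h g) ⟩
  f * h + g * h  ∎

·-*-assoc : ∀ a f g → (a · f) * g ≈ a · (f * g)
·-*-assoc a []      g = +ₘ.refl
·-*-assoc a (b ∷ f) g = begin
  (a ℙ.* b) · g + (0ℙ ∷ (a · f) * g)
    ≈⟨ +ₘ.∙-cong (·-assoc a b g) (∷-cong (≡.sym (ℙₚ.*-zeroʳ a)) (·-*-assoc a f g)) ⟩
  a · (b · g) + a · (0ℙ ∷ f * g)
    ≈⟨ ·-distribˡ-+ a (b · g) _ ⟨
  a · ((b ∷ f) * g) ∎

*-assoc : ∀ f g h → f * g * h ≈ f * (g * h)
*-assoc []      g h = +ₘ.refl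
*-assoc (a ∷ f) g h = begin
  (a · g + (0ℙ ∷ f * g)) * h
    ≈⟨ *-distribʳ-+ h (a · g) _ ⟩
  (a · g) * h + (0ℙ · h + (0ℙ ∷ f * g * h))
    ≈⟨ +ₘ.∙-cong (·-*-assoc a g h) (+ₘ.∙-cong (0·f≈0 h) (∷-cong refl (*-assoc f g h))) ⟩
  (a ∷ f) * (g * h) ∎

*-identityˡ : ∀ f → 1# * f ≈ f
*-identityˡ f = begin
  1ℙ · f + (0ℙ ∷ [])  ≈⟨ +ₘ.∙-cong (1·f≈f f) 0∷0≈0 ⟩
  f + 0#              ≈⟨ +ₘ.identityʳ f ⟩
  f                   ∎

-f≈f : ∀ f → - f ≈ f
-f≈f []      = +ₘ.refl
-f≈f (a ∷ f) = ∷-cong refl (-f≈f f)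

f+f≈0 : ∀ f → f + f ≈ 0#
f+f≈0 f = coeffwise λ n → ≡.trans (coeff-+ f f n) (ℙₚ.p+p≡0ℙ (coeff f n))

𝔽₂[x]-commutativeRing : CommutativeRing 0ℓ 0ℓ
𝔽₂[x]-commutativeRing = record
  { _≈_ = _≈_
  ; _+_ = _+_
  ; _*_ = _*_
  ; -_  = -_
  ; 0#  = 0#
  ; 1#  = 1#
  ; isCommutativeRing = record
    { isRing = record
      { +-isAbelianGroup = record
        { isGroup = record
          { isMonoid = +ₘ.isMonoid
          ; inverse  = (λ f → +ₘ.trans (+ₘ.∙-congʳ (-f≈f f)) (f+f≈0 f))
                     , (λ f → +ₘ.trans (+ₘ.∙-congˡ {f} (-f≈f f)) (f+f≈0 f))
          ; ⁻¹-cong  = λ {f} {g} p → +ₘ.trans (-f≈f f) (+ₘ.trans p (+ₘ.sym (-f≈f g)))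
          }
        ; comm = +ₘ.comm
        }
      ; *-cong = λ {f} {f′} {g} {g′} p q → +ₘ.trans (*-congˡ g p)
          (+ₘ.trans (*-comm f′ g) (+ₘ.trans (*-congˡ f′ q) (*-comm g′ f′)))
      ; *-assoc = *-assoc
      ; *-identity = *-identityˡ , λ f → +ₘ.trans (*-comm f 1#) (*-identityˡ f)
      ; distrib = *-distribˡ-+ , *-distribʳ-+
      }
    ; *-comm = *-comm
    }
  }

module R = CommutativeRing 𝔽₂[x]-commutativeRing

const-homomorphism :
  CommutativeRing.rawRing ℙₚ.+-*-commutativeRing
    -Raw-AlmostCommutative⟶ fromCommutativeRing 𝔽₂[x]-commutativeRing
const-homomorphism = record
  { ⟦_⟧    = const
  ; +-homo = λ _ _ → R.refl
  ; *-homo = λ a b → ∷-cong (≡.sym (ℙₚ.+-identityʳ (a ℙ.* b))) R.refl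
  ; -‿homo = λ _ → R.refl
  ; 0-homo = 0∷0≈0
  ; 1-homo = R.refl
  }

_≟ᶜ_ : ∀ a b → Maybe (const a ≈ const b)
a ≟ᶜ b = dec⇒maybe (map′ (λ p → R.reflexive (cong const p)) (λ p → coeff-≈ p 0) (a ℙₚ.≟ b))

-- With coefficients in 𝔽₂ the solver also cancels in characteristic 2.
open RingSolver (CommutativeRing.rawRing ℙₚ.+-*-commutativeRing)
  (fromCommutativeRing 𝔽₂[x]-commutativeRing) const-homomorphism _≟ᶜ_
  using (solve; _:=_; _:+_; _:*_; con)

-- Degrees and odd parts

f+g≈0⇒f≈g : ∀ f g → f + g ≈ 0# → f ≈ g
f+g≈0⇒f≈g f g p = begin
  f          ≈⟨ R.+-identityʳ f ⟨
  f + 0#     ≈⟨ R.+-congˡ {f} (f+f≈0 g) ⟨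
  f + (g + g) ≈⟨ R.+-assoc f g g ⟨
  f + g + g  ≈⟨ R.+-congʳ p ⟩
  g          ∎

X*f≈0∷f : ∀ f → X * f ≈ (0ℙ ∷ f)
X*f≈0∷f f = begin
  0ℙ · f + (0ℙ ∷ 1# * f)  ≈⟨ R.+-cong (0·f≈0 f) (∷-cong refl (R.*-identityˡ f)) ⟩
  (0ℙ ∷ f)                ∎

a∷f≈a+X*f : ∀ a f → (a ∷ f) ≈ const a + X * f
a∷f≈a+X*f a f = begin
  (a ∷ f)             ≈⟨ ∷-cong (≡.sym (ℙₚ.+-identityʳ a)) R.refl ⟩
  const a + (0ℙ ∷ f)  ≈⟨ R.+-congˡ {const a} (X*f≈0∷f f) ⟨
  const a + X * f     ∎

coeff-X* : ∀ f n → coeff (X * f) (suc n) ≡ coeff f n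
coeff-X* f n = coeff-≈ (X*f≈0∷f f) (suc n)

-- Degree arguments go through `Bounded` and `Monic` because `degree` has a junk value at 0. Over
-- the field with two elements every nonzero polynomial is monic.
Bounded : Poly → ℕ → Set
Bounded f n = ∀ k → n < k → coeff f k ≡ 0ℙ

record Monic (f : Poly) (n : ℕ) : Set where
  constructor monic
  field
    bounded : Bounded f n
    leading : coeff f n ≡ 1ℙ

open Monic

bounded-resp : ∀ {f g n} → f ≈ g → Bounded f n → Bounded g n
bounded-resp e b k p = ≡.trans (≡.sym (coeff-≈ e k)) (b k p)

bounded-mono : ∀ {f m n} → m ≤ n → Bounded f m → Bounded f n
bounded-mono m≤n b k p = b k (ℕₚ.≤-<-trans m≤n p)

bounded-+ : ∀ {f g n} → Bounded f n → Bounded g n → Bounded (f + g) n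
bounded-+ {f} {g} b c k p = ≡.trans (coeff-+ f g k) (cong₂ ℙ._+_ (b k p) (c k p))

-- Relaxing the bound on `f` from `m` to `k ∸ n` lets `coeff-*-top` evaluate the coefficient at `k`
-- itself; its factor `coeff f (k ∸ n)` is 0.
bounded-* : ∀ {f g m n} → Bounded f m → Bounded g n → Bounded (f * g) (m ℕ.+ n)
bounded-* {f} {g} {m} {n} b c k p = subst (λ k → coeff (f * g) k ≡ 0ℙ) k∸n+n≡k
  (≡.trans (coeff-*-top f g (k ℕ.∸ n) n (bounded-mono {f} (ℕₚ.<⇒≤ m<k∸n) b) c)
    (cong (ℙ._* coeff g n) (b (k ℕ.∸ n) m<k∸n)))
  where
  k∸n+n≡k = ℕₚ.m∸n+n≡m (ℕₚ.≤-trans (ℕₚ.m≤n+m n m) (ℕₚ.<⇒≤ p))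
  m<k∸n : m < k ℕ.∸ n
  m<k∸n = ℕₚ.+-cancelʳ-< n m (k ℕ.∸ n) (subst (m ℕ.+ n <_) (≡.sym k∸n+n≡k) p)

monic-resp : ∀ {f g n} → f ≈ g → Monic f n → Monic g n
monic-resp {f} {g} {n} e (monic b l) =
  monic (bounded-resp {f} {g} e b) (≡.trans (≡.sym (coeff-≈ e n)) l)

monic-* : ∀ {f g m n} → Monic f m → Monic g n → Monic (f * g) (m ℕ.+ n)
monic-* {f} {g} {m} {n} (monic b k) (monic c l) =
  monic (bounded-* {f} {g} b c) (≡.trans (coeff-*-top f g m n b c) (cong₂ ℙ._*_ k l))

monic-1 : Monic 1# 0
monic-1 = monic (λ { (suc k) _ → refl }) refl

monic-^ : ∀ {f n} → Monic f n → ∀ k → Monic (f ^ k) (k ℕ.* n)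
monic-^ m zero    = monic-1
monic-^ m (suc k) = monic-* m (monic-^ m k)

monic-+ : ∀ {f g m n} → Monic f n → Bounded g m → m < n → Monic (f + g) n
monic-+ {f} {g} {m} {n} (monic b l) c m<n = monic
  (bounded-+ {f} {g} b (bounded-mono {g} (ℕₚ.<⇒≤ m<n) c))
  (≡.trans (coeff-+ f g n) (cong₂ ℙ._+_ l (c n m<n)))

monic⇒≉0 : ∀ {f n} → Monic f n → f ≉ 0#
monic⇒≉0 {n = n} (monic _ l) e with () ← ≡.trans (≡.sym l) (coeff-≈ e n)

monic-degree : ∀ {f} → f ≉ 0# → Monic f (degree f)
monic-degree {f} f≉0 = monic (coeff>degree f) (coeff-degree f f≉0)

monic-unique : ∀ {f m n} → Monic f m → Monic f n → m ≡ n
monic-unique {m = m} {n} (monic b k) (monic c l) with ℕₚ.<-cmp m n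
... | tri≈ _ m≡n _ = m≡n
... | tri< m<n _ _ with () ← ≡.trans (≡.sym l) (b n m<n)
... | tri> _ _ n<m with () ← ≡.trans (≡.sym k) (c m n<m)

degree-monic : ∀ {f n} → Monic f n → degree f ≡ n
degree-monic m = monic-unique (monic-degree (monic⇒≉0 m)) m

*-≉0 : ∀ {f g} → f ≉ 0# → g ≉ 0# → f * g ≉ 0#
*-≉0 f≉0 g≉0 = monic⇒≉0 (monic-* (monic-degree f≉0) (monic-degree g≉0))

*-≉0⇒ˡ : ∀ f g → f * g ≉ 0# → f ≉ 0#
*-≉0⇒ˡ f g p f≈0 = p (R.*-congʳ {g} f≈0)

*-≉0⇒ʳ : ∀ f g → f * g ≉ 0# → g ≉ 0#
*-≉0⇒ʳ f g p g≈0 = p (R.trans (R.*-congˡ {f} g≈0) (R.zeroʳ f))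

*-cancelˡ : ∀ {f} → f ≉ 0# → ∀ g h → f * g ≈ f * h → g ≈ h
*-cancelˡ {f} f≉0 g h e with (g + h) ≈? 0#
... | yes p = f+g≈0⇒f≈g g h p
... | no  p = contradiction f*[g+h]≈0 (*-≉0 f≉0 p)
  where
  f*[g+h]≈0 : f * (g + h) ≈ 0#
  f*[g+h]≈0 = begin
    f * (g + h)    ≈⟨ R.distribˡ f g h ⟩
    f * g + f * h  ≈⟨ R.+-congʳ {f * h} e ⟩
    f * h + f * h  ≈⟨ f+f≈0 (f * h) ⟩
    0#             ∎

degree-* : ∀ f g → f * g ≉ 0# → degree (f * g) ≡ degree f ℕ.+ degree g
degree-* f g p = degree-monic
  (monic-* (monic-degree (*-≉0⇒ˡ f g p)) (monic-degree (*-≉0⇒ʳ f g p)))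

degree-zero : ∀ f → f ≈ 0# → degree f ≡ 0
degree-zero []      e = refl
degree-zero (a ∷ f) e with f ≈? 0#
... | yes _ = refl
... | no  p = contradiction (coeffwise λ n → coeff-≈ e (suc n)) p

degree-cong : ∀ {f g} → f ≈ g → degree f ≡ degree g
degree-cong {f} {g} e with f ≈? 0#
... | yes p = ≡.trans (degree-zero f p) (≡.sym (degree-zero g (R.trans (R.sym e) p)))
... | no  p = ≡.sym (degree-monic (monic-resp e (monic-degree p)))

≉-resp : ∀ {f g} → f ≈ g → f ≉ 0# → g ≉ 0#
≉-resp e p q = p (R.trans e q)

monic-0⇒≈1 : ∀ {f} → Monic f 0 → f ≈ 1#
monic-0⇒≈1 (monic b l) = coeffwise λ { zero → l ; (suc k) → b (suc k) z<s }

-- Units have degree 0, and 1 is the only nonzero constant. Hence there are no associates to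
-- identify anywhere below.
∣1⇒≈1 : ∀ {f} → f ∣ 1# → f ≈ 1#
∣1⇒≈1 {f} (q , e) = monic-0⇒≈1 (subst (Monic f) deg (monic-degree (*-≉0⇒ʳ q f qf≉0)))
  where
  qf≉0 = ≉-resp (R.sym e) (monic⇒≉0 monic-1)
  deg : degree f ≡ 0
  deg = ℕₚ.m+n≡0⇒n≡0 (degree q) (≡.trans (≡.sym (degree-* q f qf≉0))
    (degree-monic (monic-resp (R.sym e) monic-1)))

∣⇒degree≤ : ∀ {f g} → g ≉ 0# → f ∣ g → degree f ≤ degree g
∣⇒degree≤ {f} {g} g≉0 (q , e) =
  subst (degree f ≤_) (≡.trans (≡.sym (degree-* q f qf≉0)) (degree-cong e))
    (ℕₚ.m≤n+m (degree f) (degree q))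
  where qf≉0 = ≉-resp (R.sym e) g≉0

-- Frobenius on coefficient lists: the cross terms cancel and `a * a ≡ a`, so squaring only
-- interleaves zeros.
square-∷ : ∀ a f → (a ∷ f) * (a ∷ f) ≈ (a ∷ 0ℙ ∷ f * f)
square-∷ a f = begin
  (a ∷ f) * (a ∷ f)
    ≈⟨ R.*-cong (a∷f≈a+X*f a f) (a∷f≈a+X*f a f) ⟩
  (const a + X * f) * (const a + X * f)
    ≈⟨ solve 3 (λ a x f → (a :+ x :* f) :* (a :+ x :* f) := a :* a :+ x :* (con 0ℙ :+ x :* (f :* f)))
         R.refl (const a) X f ⟩
  const a * const a + X * (const 0ℙ + X * (f * f))
    ≈⟨ R.+-congˡ {const a * const a} (R.*-congˡ {X} (a∷f≈a+X*f 0ℙ (f * f))) ⟨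
  const a * const a + X * (0ℙ ∷ f * f)
    ≈⟨ R.+-congʳ {X * (0ℙ ∷ f * f)}
         (∷-cong {g = []} (≡.trans (ℙₚ.+-identityʳ _) (ℙₚ.*-idem a)) R.refl) ⟩
  const a + X * (0ℙ ∷ f * f)
    ≈⟨ a∷f≈a+X*f a (0ℙ ∷ f * f) ⟨
  (a ∷ 0ℙ ∷ f * f) ∎

parity-suc : ∀ n → ℕ.parity (suc n) ≡ ℕ.parity n ℙ.⁻¹
parity-suc n = ≡.trans (≡.sym (ℙₚ.⁻¹-involutive _)) (cong ℙ._⁻¹ (ℙₚ.suc-homo-⁻¹ n))

parity-double : ∀ n → ℕ.parity (n ℕ.+ n) ≡ 0ℙ
parity-double n = ≡.trans (ℙₚ.+-homo-+ n n) (ℙₚ.p+p≡0ℙ (ℕ.parity n))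

coeff-square-odd : ∀ f {n} → ℕ.parity n ≡ 1ℙ → coeff (f * f) n ≡ 0ℙ
coeff-square-odd []      odd = refl
coeff-square-odd (a ∷ f) {suc zero}    odd = coeff-≈ (square-∷ a f) 1
coeff-square-odd (a ∷ f) {suc (suc n)} odd =
  ≡.trans (coeff-≈ (square-∷ a f) (suc (suc n))) (coeff-square-odd f {n} odd)

coeff-square-even : ∀ f n → coeff (f * f) (n ℕ.+ n) ≡ coeff f n
coeff-square-even []      n       = refl
coeff-square-even (a ∷ f) zero    = coeff-≈ (square-∷ a f) 0
coeff-square-even (a ∷ f) (suc n) = ≡.trans
  (cong (λ k → coeff ((a ∷ f) * (a ∷ f)) (suc k)) (ℕₚ.+-suc n n))
  (≡.trans (coeff-≈ (square-∷ a f) (suc (suc (n ℕ.+ n)))) (coeff-square-even f n))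

-- In characteristic 2, every f is uniquely A² + X B²; B² is the derivative of f.
coeff-odd : ∀ A B {n} → ℕ.parity n ≡ 0ℙ →
  coeff (A * A + X * (B * B)) (suc n) ≡ coeff (B * B) n
coeff-odd A B {n} even = ≡.trans (coeff-+ (A * A) _ (suc n)) (cong₂ ℙ._+_
  (coeff-square-odd A {suc n} (≡.trans (parity-suc n) (cong ℙ._⁻¹ even))) (coeff-X* (B * B) n))

coeff-odd-part : ∀ A B n → coeff (A * A + X * (B * B)) (suc (n ℕ.+ n)) ≡ coeff B n
coeff-odd-part A B n = ≡.trans
  (coeff-odd A B {n ℕ.+ n} (parity-double n))
  (coeff-square-even B n)

odd-part-unique : ∀ A B C D → A * A + X * (B * B) ≈ C * C + X * (D * D) → B ≈ D
odd-part-unique A B C D e = coeffwise λ n →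
  ≡.trans (≡.sym (coeff-odd-part A B n)) (≡.trans (coeff-≈ e _) (coeff-odd-part C D n))

-- Prepending a coefficient multiplies by `X`, which exchanges the parts: `A` becomes the new odd
-- part, and `X * X * (B * B)`, a square, absorbs `a` as its constant term.
even-odd-parts : ∀ f → ∃₂ λ A B → f ≈ A * A + X * (B * B)
even-odd-parts []      = 0# , 0# , R.sym (R.zeroʳ X)
even-odd-parts (a ∷ f) with A , B , e ← even-odd-parts f = (a ∷ B) , A , (begin
  (a ∷ f)                                    ≈⟨ a∷f≈a+X*f a f ⟩
  const a + X * f                            ≈⟨ R.+-congˡ {const a} (R.*-congˡ {X} e) ⟩
  const a + X * (A * A + X * (B * B))
    ≈⟨ solve 4 (λ a x A B → a :+ x :* (A :* A :+ x :* (B :* B))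
                    := (a :+ x :* (con 0ℙ :+ x :* (B :* B))) :+ x :* (A :* A))
         R.refl (const a) X A B ⟩
  const a + X * (const 0ℙ + X * (B * B)) + X * (A * A)
    ≈⟨ R.+-congʳ {X * (A * A)} (R.+-congˡ {const a} (R.*-congˡ {X} (a∷f≈a+X*f 0ℙ (B * B)))) ⟨
  const a + X * (0ℙ ∷ B * B) + X * (A * A)
    ≈⟨ R.+-congʳ {X * (A * A)} (a∷f≈a+X*f a (0ℙ ∷ B * B)) ⟨
  (a ∷ 0ℙ ∷ B * B) + X * (A * A)
    ≈⟨ R.+-congʳ {X * (A * A)} (square-∷ a B) ⟨
  (a ∷ B) * (a ∷ B) + X * (A * A)            ∎)

-- Irreducible polynomials

open SemiringDivisibility R.semiring using
  (∣ʳ-refl; ∣ʳ-reflexive; ∣ʳ-trans; ∣ʳ-respʳ-≈; ∣ʳ-respˡ-≈; x∣ʳyx; x∣y∧y≉0⇒x≉0; x∣ʳy⇒xz∣ʳyz)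
  renaming (1∣_ to 1∣)
open SemigroupDivisibility R.*-commutativeSemigroup using (x∣xy; x∣y⇒zx∣zy)

1≉0 : 1# ≉ 0#
1≉0 = monic⇒≉0 monic-1

irreducible⇒≉0 : ∀ {P} → Irreducible P → P ≉ 0#
irreducible⇒≉0 = Primality.Irreducible⇒≉0 R.semiring (λ e → 1≉0 (R.sym e))

∣-+ : ∀ {d f g} → d ∣ f → d ∣ g → d ∣ f + g
∣-+ {d} {f} {g} (q , e) (r , e′) = (q + r) , (begin
  (q + r) * d    ≈⟨ R.distribʳ d q r ⟩
  q * d + r * d  ≈⟨ R.+-cong e e′ ⟩
  f + g          ∎)

monic-X : Monic X 1
monic-X = monic (λ { (suc zero) (s≤s ()) ; (suc (suc k)) _ → refl }) refl

-- Bézout identities and Euclid's lemma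

leading-cancels : ∀ {f g n} → Monic f n → Monic g n → f + g ≉ 0# → degree (f + g) < n
leading-cancels {f} {g} {n} mf mg f+g≉0 = ℕₚ.≰⇒> λ n≤deg → contradiction
  (≡.trans (≡.sym (coeff-degree (f + g) f+g≉0)) (vanishes (ℕₚ.m≤n⇒m<n∨m≡n n≤deg))) λ ()
  where
  vanishes : ∀ {k} → n < k ⊎ n ≡ k → coeff (f + g) k ≡ 0ℙ
  vanishes {k} (inj₁ n<k)  = bounded-+ {f} {g} (bounded mf) (bounded mg) k n<k
  vanishes {k} (inj₂ refl) = ≡.trans (coeff-+ f g n) (cong₂ ℙ._+_ (leading mf) (leading mg))

Bézout : Poly → Poly → Set
Bézout f g = ∃ λ d → d ∣ f × d ∣ g × ∃₂ λ u v → d ≈ u * f + v * g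

bézout-sym : ∀ {f g} → Bézout f g → Bézout g f
bézout-sym {f} {g} (d , d∣f , d∣g , u , v , e) =
  d , d∣g , d∣f , v , u , R.trans e (R.+-comm (u * f) (v * g))

-- One Euclidean step: `f` and `g + h * f` generate the same ideal as `f` and `g`, since adding
-- `h * f` twice changes nothing.
bézout-shear : ∀ {f g} h → Bézout f (g + h * f) → Bézout f g
bézout-shear {f} {g} h (d , d∣f , d∣g+hf , u , v , e) =
  d , d∣f , ∣ʳ-respʳ-≈ g+hf+hf≈g (∣-+ d∣g+hf (∣ʳ-trans d∣f (x∣ʳyx f h))) , u + v * h , v , (begin
    d                        ≈⟨ e ⟩
    u * f + v * (g + h * f)
      ≈⟨ solve 5 (λ u v f g h → u :* f :+ v :* (g :+ h :* f) := (u :+ v :* h) :* f :+ v :* g)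
           R.refl u v f g h ⟩
    (u + v * h) * f + v * g  ∎)
  where
  g+hf+hf≈g : g + h * f + h * f ≈ g
  g+hf+hf≈g = solve 2 (λ g k → g :+ k :+ k := g) R.refl g (h * f)

bézout-0 : ∀ f → Bézout f 0#
bézout-0 f = f , ∣ʳ-refl , (0# , R.refl) , 1# , 0# ,
  R.sym (R.trans (R.+-identityʳ (1# * f)) (R.*-identityˡ f))

bézout-respʳ : ∀ {f g g′} → g ≈ g′ → Bézout f g → Bézout f g′
bézout-respʳ {f} g≈g′ (d , d∣f , d∣g , u , v , e) =
  d , d∣f , ∣ʳ-respʳ-≈ g≈g′ d∣g , u , v , R.trans e (R.+-congˡ {u * f} (R.*-congˡ {v} g≈g′))

-- Adding the shift `X ^ k * f` kills the leading term of `g`. A vanishing result is treated apart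
-- because its `degree` is junk and proves no descent.
bézout-reduce : ∀ f g → f ≉ 0# → g ≉ 0# → degree f ≤ degree g →
  (∀ g′ → g′ ≉ 0# → degree g′ < degree g → Bézout f g′) → Bézout f g
bézout-reduce f g f≉0 g≉0 f≤g rec = bézout-shear (X ^ k) (go (_ ≈? 0#))
  where
  k  = degree g ℕ.∸ degree f
  g′ = g + X ^ k * f

  monic-X^k*f : Monic (X ^ k * f) (degree g)
  monic-X^k*f = subst (Monic (X ^ k * f))
    (≡.trans (cong (ℕ._+ degree f) (ℕₚ.*-identityʳ k)) (ℕₚ.m∸n+n≡m f≤g))
    (monic-* (monic-^ monic-X k) (monic-degree f≉0))

  go : Dec (g′ ≈ 0#) → Bézout f g′
  go (yes g′≈0) = bézout-respʳ (R.sym g′≈0) (bézout-0 f)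
  go (no  g′≉0) = rec g′ g′≉0 (leading-cancels (monic-degree g≉0) monic-X^k*f g′≉0)

bézout : ∀ n f g → f ≉ 0# → g ≉ 0# → degree f ℕ.+ degree g < n → Bézout f g
bézout (suc n) f g f≉0 g≉0 (s≤s p) with ℕₚ.≤-total (degree f) (degree g)
... | inj₁ f≤g = bézout-reduce f g f≉0 g≉0 f≤g λ g′ g′≉0 g′<g →
  bézout n f g′ f≉0 g′≉0 (ℕₚ.<-≤-trans (ℕₚ.+-monoʳ-< (degree f) g′<g) p)
... | inj₂ g≤f = bézout-sym (bézout-reduce g f g≉0 f≉0 g≤f λ f′ f′≉0 f′<f →
  bézout n g f′ g≉0 f′≉0 (ℕₚ.<-≤-trans (ℕₚ.+-monoʳ-< (degree g) f′<f)
    (ℕₚ.≤-trans (ℕₚ.≤-reflexive (ℕₚ.+-comm (degree g) (degree f))) p)))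

euclid : ∀ {P} → Irreducible P → ∀ A B → P ∤ A → P ∣ A * B → P ∣ B
euclid {P} irr@(mkIrred P∤1 split) A B P∤A P∣AB
  with bézout _ P A (irreducible⇒≉0 irr) (λ A≈0 → P∤A (0# , R.sym A≈0)) (ℕₚ.n<1+n _)
... | d , (q , qd≈P) , d∣A , u , v , e with split (R.sym qd≈P)
...   | inj₁ q∣1 = contradiction (∣ʳ-respˡ-≈ d≈P d∣A) P∤A
  where
  d≈P : d ≈ P
  d≈P = R.trans (R.sym (R.*-identityˡ d))
    (R.trans (R.*-congʳ {d} {1#} {q} (R.sym (∣1⇒≈1 q∣1))) qd≈P)
...   | inj₂ d∣1 = ∣ʳ-respʳ-≈ combination (∣-+ (x∣ʳyx P (u * B)) (∣ʳ-trans P∣AB (x∣ʳyx (A * B) v)))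
  where
  combination : u * B * P + v * (A * B) ≈ B
  combination = begin
    u * B * P + v * (A * B)
      ≈⟨ solve 5 (λ u v A B P → u :* B :* P :+ v :* (A :* B) := (u :* P :+ v :* A) :* B)
           R.refl u v A B P ⟩
    (u * P + v * A) * B  ≈⟨ R.*-congʳ {B} (R.trans (R.sym e) (∣1⇒≈1 d∣1)) ⟩
    1# * B               ≈⟨ R.*-identityˡ B ⟩
    B                    ∎

∣-^⇒∣ : ∀ {P} → Irreducible P → ∀ A n → P ∣ A ^ n → P ∣ A
∣-^⇒∣ irr A zero    P∣1 = contradiction P∣1 (Irreducible.p∤1 irr)
∣-^⇒∣ {P} irr A (suc n) P∣A^n with P ∣? A
... | yes P∣A = P∣A
... | no  P∤A = ∣-^⇒∣ irr A n (euclid irr A (A ^ n) P∤A P∣A^n)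

-- In `q * f ≈ P * A`, Euclid's lemma puts `P` into `q`, where it cancels.
coprime-divisor : ∀ {P} → Irreducible P → ∀ {f A} → P ∤ f → f ∣ P * A → f ∣ A
coprime-divisor {P} irr {f} {A} P∤f (q , qf≈PA) = cancel (euclid irr f q P∤f P∣fq)
  where
  P∣fq : P ∣ f * q
  P∣fq = ∣ʳ-respʳ-≈ (R.trans (R.sym qf≈PA) (R.*-comm q f)) (x∣xy P A)

  cancel : P ∣ q → f ∣ A
  cancel (r , rP≈q) = r , *-cancelˡ (irreducible⇒≉0 irr) (r * f) A (begin
    P * (r * f)  ≈⟨ solve 3 (λ P r f → P :* (r :* f) := r :* P :* f) R.refl P r f ⟩
    r * P * f    ≈⟨ R.*-congʳ {f} rP≈q ⟩
    q * f        ≈⟨ qf≈PA ⟩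
    P * A        ∎)

-- Divisor lists and existence of irreducible factors

open Membership R.setoid using (_∈_; find; lose)
open UniqueSetoid R.setoid using (Unique)

polys<-unique : ∀ n → Unique (polys< n)
polys<-unique zero    = [] ∷ []
polys<-unique (suc n) = Uniqueₚ.++⁺ R.setoid
  (Uniqueₚ.map⁺ R.setoid R.setoid tail-cong (polys<-unique n))
  (Uniqueₚ.map⁺ R.setoid R.setoid tail-cong (polys<-unique n))
  disjoint
  where
  tail-cong : ∀ {a f g} → (a ∷ f) ≈ (a ∷ g) → f ≈ g
  tail-cong e = coeffwise λ n → coeff-≈ e (suc n)

  disjoint : Disjoint R.setoid (map (0ℙ ∷_) (polys< n)) (map (1ℙ ∷_) (polys< n))
  disjoint (p , q) with _ , _ , e ← ∈ₚ.∈-map⁻ R.setoid R.setoid p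
                      | _ , _ , e′ ← ∈ₚ.∈-map⁻ R.setoid R.setoid q
    with () ← ≡.trans (≡.sym (coeff-≈ e 0)) (coeff-≈ e′ 0)

-- The list inside `σ`, so that `σ A` is `∑ₗ (divisors A)` by definition.
divisors : Poly → List Poly
divisors A = filter (_∣? A) (polys< (length A))

-- Everything is up to `≈`. Two such lists for the same `A` have equal sums, so σ can be computed
-- from lists that follow a factorisation instead of from the exhaustive search.
record IsDivisorList (A : Poly) (ds : List Poly) : Set where
  field
    unique   : Unique ds
    sound    : ∀ {f} → f ∈ ds → f ∣ A
    complete : ∀ {f} → f ∣ A → f ∈ ds

open IsDivisorList

divisors-isDivisorList : ∀ {A} → A ≉ 0# → IsDivisorList A (divisors A)
divisors-isDivisorList {A} A≉0 = record
  { unique   = Uniqueₚ.filter⁺ R.setoid (_∣? A) (polys<-unique (length A))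
  ; sound    = λ p → proj₂ (∈ₚ.∈-filter⁻ R.setoid (_∣? A) ∣ʳ-respˡ-≈ {xs = polys< (length A)} p)
  ; complete = λ {f} f∣A → ∈ₚ.∈-filter⁺ R.setoid (_∣? A) ∣ʳ-respˡ-≈ (listed f f∣A) f∣A
  }
  where
  listed : ∀ f → f ∣ A → f ∈ polys< (length A)
  listed f (q , qf≈A) = Any.map
    (λ { refl → R.sym (coeff-pad (length A) f
           (quotient-bound f q A A≉0 (R.trans (R.*-comm f q) qf≈A))) })
    (pad∈polys< (length A) f)

-- The finite divisor list is searched for a divisor other than 1 of smaller degree. One that is
-- found is factored further; if there is none, `F` itself is irreducible.
∃-irreducible-factor : ∀ n F → F ≉ 0# → ¬ F ≈ 1# → degree F < n → ∃ λ P → Irreducible P × P ∣ F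
∃-irreducible-factor (suc n) F F≉0 F≉1 (s≤s p)
  with any? (λ q → ¬? (q ≈? 1#) ×-dec (degree q ℕ.<? degree F)) (divisors F)
... | yes found = let
      q , q∈ , q≉1 , q<F = find found
      q∣F = sound (divisors-isDivisorList F≉0) q∈
      P , irr , P∣q = ∃-irreducible-factor n q (x∣y∧y≉0⇒x≉0 q∣F F≉0) q≉1 (ℕₚ.<-≤-trans q<F p)
    in P , irr , ∣ʳ-trans P∣q q∣F
... | no none = F , mkIrred (λ F∣1 → F≉1 (∣1⇒≈1 F∣1)) split , ∣ʳ-refl
  where
  split : ∀ {x y} → F ≈ x * y → x ∣ 1# ⊎ y ∣ 1#
  split {x} {y} e with x ≈? 1# | degree x ℕ.<? degree F
  ... | yes x≈1 | _       = inj₁ (∣ʳ-reflexive x≈1)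
  ... | no  x≉1 | yes x<F = contradiction
    (lose (λ e (u , v) → (λ z → u (R.trans e z)) , subst (_< degree F) (degree-cong e) v)
      (complete (divisors-isDivisorList F≉0) (∣ʳ-respʳ-≈ (R.sym e) (x∣xy x y))) (x≉1 , x<F)) none
  ... | no  x≉1 | no  x≮F = inj₂ (∣ʳ-reflexive (monic-0⇒≈1 (subst (Monic y) deg-y≡0
      (monic-degree (*-≉0⇒ʳ x y xy≉0)))))
    where
    xy≉0 = ≉-resp e F≉0
    deg-y≡0 : degree y ≡ 0
    deg-y≡0 = ℕₚ.n≤0⇒n≡0 (ℕₚ.+-cancelˡ-≤ (degree x) (degree y) 0
      (ℕₚ.≤-trans (ℕₚ.≤-reflexive (≡.trans (≡.sym (degree-* x y xy≉0)) (≡.sym (degree-cong e))))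
        (ℕₚ.≤-trans (ℕₚ.≮⇒≥ x≮F) (ℕₚ.≤-reflexive (≡.sym (ℕₚ.+-identityʳ _))))))

-- Divisor sums

-- The induction step of `∑ₗ-sameElements`: without duplicates, deleting one entry removes its whole
-- `≈`-class.
remove : ∀ {x ys} → Unique ys → x ∈ ys → ∃ λ zs → Unique zs × ∑ₗ ys ≈ x + ∑ₗ zs ×
  (∀ {f} → f ∈ zs → f ∈ ys × ¬ f ≈ x) × (∀ {f} → f ∈ ys → ¬ f ≈ x → f ∈ zs)
remove {x} {y ∷ ys} (y∉ys ∷ ys!) (here x≈y) =
  ys , ys! , R.+-congʳ {∑ₗ ys} (R.sym x≈y)
  , (λ f∈ → there f∈ , λ f≈x →
      Allₚ.All¬⇒¬Any y∉ys (Any.map (R.trans (R.sym (R.trans f≈x x≈y))) f∈))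
  , λ { (here f≈y) f≉x → contradiction (R.trans f≈y (R.sym x≈y)) f≉x ; (there f∈) _ → f∈ }
remove {x} {y ∷ ys} (y∉ys ∷ ys!) (there x∈)
  with zs , zs! , e , to , from ← remove ys! x∈ =
  y ∷ zs
  , All.tabulateₛ R.setoid (λ f∈ y≈f →
      Allₚ.All¬⇒¬Any y∉ys (Any.map (R.trans y≈f) (proj₁ (to f∈)))) ∷ zs!
  , (begin
      y + ∑ₗ ys        ≈⟨ R.+-congˡ {y} e ⟩
      y + (x + ∑ₗ zs)  ≈⟨ solve 3 (λ x y z → y :+ (x :+ z) := x :+ (y :+ z)) R.refl x y (∑ₗ zs) ⟩
      x + (y + ∑ₗ zs)  ∎)
  , (λ { (here f≈y) → here f≈y , λ f≈x →
           Allₚ.All¬⇒¬Any y∉ys (Any.map (R.trans (R.trans (R.sym f≈y) f≈x)) x∈)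
       ; (there f∈) → there (proj₁ (to f∈)) , proj₂ (to f∈) })
  , λ { (here f≈y) _ → here f≈y ; (there f∈) f≉x → there (from f∈ f≉x) }

∑ₗ-sameElements : ∀ {xs ys} → Unique xs → Unique ys →
  (∀ {f} → f ∈ xs → f ∈ ys) → (∀ {f} → f ∈ ys → f ∈ xs) → ∑ₗ xs ≈ ∑ₗ ys
∑ₗ-sameElements {[]} {[]}     _ _ _ _    = R.refl
∑ₗ-sameElements {[]} {y ∷ ys} _ _ _ from with () ← from (here R.refl)
∑ₗ-sameElements {x ∷ xs} {ys} (x∉xs ∷ xs!) ys! to from
  with zs , zs! , e , zs⊆ , ⊆zs ← remove ys! (to (here R.refl)) = begin
    x + ∑ₗ xs  ≈⟨ R.+-congˡ {x} (∑ₗ-sameElements xs! zs! xs⊆zs zs⊆xs) ⟩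
    x + ∑ₗ zs  ≈⟨ e ⟨
    ∑ₗ ys      ∎
  where
  xs⊆zs : ∀ {f} → f ∈ xs → f ∈ zs
  xs⊆zs f∈ = ⊆zs (to (there f∈)) λ f≈x → Allₚ.All¬⇒¬Any x∉xs (Any.map (R.trans (R.sym f≈x)) f∈)

  zs⊆xs : ∀ {f} → f ∈ zs → f ∈ xs
  zs⊆xs f∈ with from (proj₁ (zs⊆ f∈))
  ... | here f≈x = contradiction f≈x (proj₂ (zs⊆ f∈))
  ... | there f∈xs = f∈xs

∑ₗ-++ : ∀ xs ys → ∑ₗ (xs ++ ys) ≈ ∑ₗ xs + ∑ₗ ys
∑ₗ-++ []       ys = R.refl
∑ₗ-++ (x ∷ xs) ys = R.trans (R.+-congˡ {x} (∑ₗ-++ xs ys)) (R.sym (R.+-assoc x (∑ₗ xs) (∑ₗ ys)))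

∑ₗ-map-* : ∀ f xs → ∑ₗ (map (f *_) xs) ≈ f * ∑ₗ xs
∑ₗ-map-* f []       = R.sym (R.zeroʳ f)
∑ₗ-map-* f (x ∷ xs) = R.trans (R.+-congˡ {f * x} (∑ₗ-map-* f xs)) (R.sym (R.distribˡ f x (∑ₗ xs)))

σ-divisorList : ∀ {A ds} → A ≉ 0# → IsDivisorList A ds → σ A ≈ ∑ₗ ds
σ-divisorList {A} A≉0 D = ∑ₗ-sameElements (unique E) (unique D)
  (complete D ∘ sound E) (complete E ∘ sound D)
  where E = divisors-isDivisorList A≉0

isDivisorList-resp : ∀ {A B ds} → A ≈ B → IsDivisorList A ds → IsDivisorList B ds
isDivisorList-resp A≈B D = record
  { unique   = unique D
  ; sound    = λ p → ∣ʳ-respʳ-≈ A≈B (sound D p)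
  ; complete = λ d → complete D (∣ʳ-respʳ-≈ (R.sym A≈B) d)
  }

σ-cong : ∀ {A B} → A ≉ 0# → A ≈ B → σ A ≈ σ B
σ-cong A≉0 A≈B = σ-divisorList A≉0
  (isDivisorList-resp (R.sym A≈B) (divisors-isDivisorList (≉-resp A≈B A≉0)))

isDivisorList-1 : IsDivisorList 1# (1# ∷ [])
isDivisorList-1 = record
  { unique   = [] ∷ []
  ; sound    = λ { (here f≈1) → ∣ʳ-reflexive f≈1 }
  ; complete = λ f∣1 → here (∣1⇒≈1 f∣1)
  }

σ-1 : ∀ {A} → A ≈ 1# → σ A ≈ 1#
σ-1 {A} A≈1 = R.trans
  (σ-divisorList (≉-resp (R.sym A≈1) 1≉0) (isDivisorList-resp (R.sym A≈1) isDivisorList-1))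
  (R.+-identityʳ 1#)

∣-cancelˡ : ∀ {P f A} → P ≉ 0# → P * f ∣ P * A → f ∣ A
∣-cancelˡ {P} {f} {A} P≉0 (r , e) = r , *-cancelˡ P≉0 (r * f) A (begin
  P * (r * f)  ≈⟨ solve 3 (λ P r f → P :* (r :* f) := r :* (P :* f)) R.refl P r f ⟩
  r * (P * f)  ≈⟨ e ⟩
  P * A        ∎)

module _ {P A ds} (irr : Irreducible P) (D : IsDivisorList A ds) where

  private
    P≉0 = irreducible⇒≉0 irr

  multiples-unique : Unique (map (P *_) ds)
  multiples-unique = Uniqueₚ.map⁺ R.setoid R.setoid (λ {f} {g} → *-cancelˡ P≉0 f g) (unique D)

  multiples-sound : ∀ {f} → f ∈ map (P *_) ds → P ∣ f × f ∣ P * A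
  multiples-sound f∈ with g , g∈ , f≈Pg ← ∈ₚ.∈-map⁻ R.setoid R.setoid f∈ =
    ∣ʳ-respʳ-≈ (R.sym f≈Pg) (x∣xy P g) , ∣ʳ-respˡ-≈ (R.sym f≈Pg) (x∣y⇒zx∣zy P (sound D g∈))

  multiples-complete : ∀ {f} → P ∣ f → f ∣ P * A → f ∈ map (P *_) ds
  multiples-complete {f} (q , qP≈f) f∣PA =
    Any.map (R.trans (R.trans (R.sym qP≈f) (R.*-comm q P)))
      (∈ₚ.∈-map⁺ R.setoid R.setoid (R.*-congˡ {P})
        (complete D (∣-cancelˡ P≉0 (∣ʳ-respˡ-≈ (R.trans (R.sym qP≈f) (R.*-comm q P)) f∣PA))))

  -- A divisor of `P * A` either avoids `P`, and then divides `A`, or is `P` times a divisor of `A`.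
  -- `P ∤ A` keeps the two kinds apart, so nothing is listed twice.
  isDivisorList-* : P ∤ A → IsDivisorList (P * A) (ds ++ map (P *_) ds)
  isDivisorList-* P∤A = record
    { unique   = Uniqueₚ.++⁺ R.setoid (unique D) multiples-unique λ (f∈ds , f∈Pds) →
        P∤A (∣ʳ-trans (proj₁ (multiples-sound f∈Pds)) (sound D f∈ds))
    ; sound    = λ f∈ → [ (λ f∈ds → ∣ʳ-trans (sound D f∈ds) (x∣ʳyx A P))
                        , (λ f∈Pds → proj₂ (multiples-sound f∈Pds)) ]′
                        (∈ₚ.∈-++⁻ R.setoid ds f∈)
    ; complete = complete′
    }
    where
    complete′ : ∀ {f} → f ∣ P * A → f ∈ ds ++ map (P *_) ds
    complete′ {f} f∣PA with P ∣? f
    ... | yes P∣f = ∈ₚ.∈-++⁺ʳ R.setoid ds (multiples-complete P∣f f∣PA)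
    ... | no  P∤f = ∈ₚ.∈-++⁺ˡ R.setoid (complete D (coprime-divisor irr P∤f f∣PA))

σ-* : ∀ {P A} → Irreducible P → A ≉ 0# → P ∤ A → σ (P * A) ≈ (1# + P) * σ A
σ-* {P} {A} irr A≉0 P∤A = begin
  σ (P * A)
    ≈⟨ σ-divisorList (*-≉0 (irreducible⇒≉0 irr) A≉0)
         (isDivisorList-* irr (divisors-isDivisorList A≉0) P∤A) ⟩
  ∑ₗ (divisors A ++ map (P *_) (divisors A))  ≈⟨ ∑ₗ-++ (divisors A) _ ⟩
  σ A + ∑ₗ (map (P *_) (divisors A))          ≈⟨ R.+-congˡ {σ A} (∑ₗ-map-* P (divisors A)) ⟩
  σ A + P * σ A
    ≈⟨ solve 2 (λ s P → s :+ P :* s := (con 1ℙ :+ P) :* s) R.refl (σ A) P ⟩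
  (1# + P) * σ A                              ∎

-- `n` counts the terms, so the top exponent is `n ∸ 1`. The sum is a value of the all-ones list
-- because `φ p` has these coefficients for prime `p`.
geometric : Poly → ℕ → Poly
geometric f n = replicate n 1ℙ ⟨ f ⟩

powers : Poly → ℕ → List Poly
powers P zero    = 1# ∷ []
powers P (suc n) = 1# ∷ map (P *_) (powers P n)

module _ {P} (irr : Irreducible P) where

  powers-isDivisorList : ∀ n → IsDivisorList (P ^ n) (powers P n)
  powers-isDivisorList zero    = isDivisorList-1
  powers-isDivisorList (suc n) = record
    { unique   = All.tabulateₛ R.setoid (λ f∈ 1≈f →
        Irreducible.p∤1 irr (∣ʳ-respʳ-≈ (R.sym 1≈f) (proj₁ (multiples-sound irr D f∈))))
        ∷ multiples-unique irr D
    ; sound    = λ { (here f≈1) → ∣ʳ-respˡ-≈ (R.sym f≈1) (1∣ (P ^ suc n))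
                   ; (there f∈) → proj₂ (multiples-sound irr D f∈) }
    ; complete = complete′
    }
    where
    D = powers-isDivisorList n

    coprime⇒≈1 : ∀ {f} → P ∤ f → ∀ n → f ∣ P ^ n → f ≈ 1#
    coprime⇒≈1 P∤f zero    f∣1 = ∣1⇒≈1 f∣1
    coprime⇒≈1 P∤f (suc n) d   = coprime⇒≈1 P∤f n (coprime-divisor irr P∤f d)

    complete′ : ∀ {f} → f ∣ P ^ suc n → f ∈ powers P (suc n)
    complete′ {f} d with P ∣? f
    ... | yes P∣f = there (multiples-complete irr D P∣f d)
    ... | no  P∤f = here (coprime⇒≈1 P∤f (suc n) d)

  ∑ₗ-powers : ∀ n → ∑ₗ (powers P n) ≈ geometric P (suc n)
  ∑ₗ-powers zero    = R.+-congˡ {1#} (R.sym (R.zeroʳ P))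
  ∑ₗ-powers (suc n) = R.+-congˡ {1#} (R.trans (∑ₗ-map-* P (powers P n)) (R.*-congˡ {P} (∑ₗ-powers n)))

  σ-^ : ∀ n → σ (P ^ n) ≈ geometric P (suc n)
  σ-^ n = R.trans (σ-divisorList P^n≉0 (powers-isDivisorList n)) (∑ₗ-powers n)
    where P^n≉0 = monic⇒≉0 (monic-^ (monic-degree (irreducible⇒≉0 irr)) n)

-- Mersenne primes

open Exp R.semiring using (^-homo-*)
open +-*-Solver using () renaming
  (solve to solveℕ; con to conℕ; _:+_ to _:+ℕ_; _:*_ to _:*ℕ_; _:=_ to _:=ℕ_)

split : ℕ → ℕ → Poly
split u v = X ^ u * (X + 1#) ^ v

monic-X+1 : Monic (X + 1#) 1
monic-X+1 = monic-+ {g = 1#} monic-X (bounded monic-1) z<s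

monic-split : ∀ u v → Monic (split u v) (u ℕ.+ v)
monic-split u v = subst (Monic (split u v))
  (cong₂ ℕ._+_ (ℕₚ.*-identityʳ u) (ℕₚ.*-identityʳ v))
  (monic-* (monic-^ monic-X u) (monic-^ monic-X+1 v))

split-* : ∀ a b u v → split a b * split u v ≈ split (a ℕ.+ u) (b ℕ.+ v)
split-* a b u v = begin
  X ^ a * (X + 1#) ^ b * (X ^ u * (X + 1#) ^ v)
    ≈⟨ solve 4 (λ a b u v → a :* b :* (u :* v) := a :* u :* (b :* v))
         R.refl (X ^ a) ((X + 1#) ^ b) (X ^ u) ((X + 1#) ^ v) ⟩
  X ^ a * X ^ u * ((X + 1#) ^ b * (X + 1#) ^ v)
    ≈⟨ R.*-cong (^-homo-* X a u) (^-homo-* (X + 1#) b v) ⟨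
  X ^ (a ℕ.+ u) * (X + 1#) ^ (b ℕ.+ v) ∎

half : ∀ n → ∃ λ k → n ≡ k ℕ.+ k ⊎ n ≡ suc (k ℕ.+ k)
half zero    = 0 , inj₁ refl
half (suc n) with half n
... | k , inj₁ e = k , inj₂ (cong suc e)
... | k , inj₂ e = suc k , inj₁ (cong suc (≡.trans e (≡.sym (ℕₚ.+-suc k k))))

-- `nonSquare` also records the excess of `n` over twice `i + j`: 1 when exactly one exponent is
-- odd, 2 when both are. These two offsets lead to the two values of `e`.
data SplitParts (f : Poly) (n : ℕ) : Set where
  isSquare  : ∀ i j → f ≈ split i j * split i j → SplitParts f n
  nonSquare : ∀ A i j → f ≈ A * A + X * (split i j * split i j) →
    n ≡ suc (i ℕ.+ j ℕ.+ (i ℕ.+ j)) ⊎ n ≡ suc (suc (i ℕ.+ j ℕ.+ (i ℕ.+ j))) →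
    SplitParts f n

splitParts : ∀ u v → SplitParts (split u v) (u ℕ.+ v)
splitParts u v with half u | half v
... | i , inj₁ refl | j , inj₁ refl = isSquare i j (R.sym (split-* i j i j))
... | i , inj₂ refl | j , inj₁ refl = nonSquare 0# i j (begin
    X * X ^ (i ℕ.+ i) * (X + 1#) ^ (j ℕ.+ j)
      ≈⟨ R.*-assoc X (X ^ (i ℕ.+ i)) ((X + 1#) ^ (j ℕ.+ j)) ⟩
    X * split (i ℕ.+ i) (j ℕ.+ j)
      ≈⟨ R.*-congˡ {X} (split-* i j i j) ⟨
    X * (split i j * split i j) ∎)
  (inj₁ (cong suc (solveℕ 2 (λ i j → i :+ℕ i :+ℕ (j :+ℕ j) :=ℕ i :+ℕ j :+ℕ (i :+ℕ j)) refl i j)))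
... | i , inj₁ refl | j , inj₂ refl = nonSquare (split i j) i j (begin
    X ^ (i ℕ.+ i) * ((X + 1#) * (X + 1#) ^ (j ℕ.+ j))
      ≈⟨ solve 3 (λ x a b → a :* ((x :+ con 1ℙ) :* b) := a :* b :+ x :* (a :* b))
           R.refl X (X ^ (i ℕ.+ i)) ((X + 1#) ^ (j ℕ.+ j)) ⟩
    split (i ℕ.+ i) (j ℕ.+ j) + X * split (i ℕ.+ i) (j ℕ.+ j)
      ≈⟨ R.+-cong (split-* i j i j) (R.*-congˡ {X} (split-* i j i j)) ⟨
    split i j * split i j + X * (split i j * split i j) ∎)
  (inj₁ (solveℕ 2 (λ i j → i :+ℕ i :+ℕ (conℕ 1 :+ℕ (j :+ℕ j))
    :=ℕ conℕ 1 :+ℕ (i :+ℕ j :+ℕ (i :+ℕ j))) refl i j))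
... | i , inj₂ refl | j , inj₂ refl = nonSquare (X * split i j) i j (begin
    X * X ^ (i ℕ.+ i) * ((X + 1#) * (X + 1#) ^ (j ℕ.+ j))
      ≈⟨ solve 3 (λ x a b → x :* a :* ((x :+ con 1ℙ) :* b) := x :* x :* (a :* b) :+ x :* (a :* b))
           R.refl X (X ^ (i ℕ.+ i)) ((X + 1#) ^ (j ℕ.+ j)) ⟩
    X * X * split (i ℕ.+ i) (j ℕ.+ j) + X * split (i ℕ.+ i) (j ℕ.+ j)
      ≈⟨ R.+-cong (R.*-congˡ {X * X} (split-* i j i j)) (R.*-congˡ {X} (split-* i j i j)) ⟨
    X * X * (split i j * split i j) + X * (split i j * split i j)
      ≈⟨ R.+-congʳ {X * (split i j * split i j)}
           (solve 2 (λ x Q → x :* x :* (Q :* Q) := x :* Q :* (x :* Q)) R.refl X (split i j)) ⟩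
    X * split i j * (X * split i j) + X * (split i j * split i j) ∎)
  (inj₂ (solveℕ 2 (λ i j → conℕ 1 :+ℕ (i :+ℕ i) :+ℕ (conℕ 1 :+ℕ (j :+ℕ j))
    :=ℕ conℕ 2 :+ℕ (i :+ℕ j :+ℕ (i :+ℕ j))) refl i j))

monic-mersenne : ∀ {M a b} → 1 ≤ a → M ≈ 1# + split a b → Monic M (a ℕ.+ b)
monic-mersenne {M} {a} {b} 1≤a e =
  monic-resp (R.trans (R.+-comm (split a b) 1#) (R.sym e))
    (monic-+ {g = 1#} (monic-split a b) (bounded monic-1) (ℕₚ.≤-trans 1≤a (ℕₚ.m≤m+n a b)))

degree-mersenne : ∀ {M} → MersennePrime M → 2 ≤ degree M
degree-mersenne (_ , a , b , 1≤a , 1≤b , e) =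
  subst (2 ≤_) (≡.sym (degree-monic (monic-mersenne 1≤a e))) (ℕₚ.+-mono-≤ 1≤a 1≤b)

-- If both exponents were even, `M` would be the square of `1# + split i j`, against irreducibility.
mersenne-parts : ∀ {M} → MersennePrime M → ∃₂ λ A i → ∃ λ j →
  M ≈ A * A + X * (split i j * split i j) ×
  (degree M ≡ suc (i ℕ.+ j ℕ.+ (i ℕ.+ j)) ⊎ degree M ≡ suc (suc (i ℕ.+ j ℕ.+ (i ℕ.+ j))))
mersenne-parts {M} (mkIrred M∤1 factor , a , b , 1≤a , 1≤b , M≈) with splitParts a b
... | isSquare i j e = contradiction (∣ʳ-respˡ-≈ (R.sym M≈S²) S²∣1) M∤1
  where
  S = 1# + split i j
  M≈S² : M ≈ S * S
  M≈S² = begin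
    M                            ≈⟨ M≈ ⟩
    1# + split a b               ≈⟨ R.+-congˡ {1#} e ⟩
    1# + split i j * split i j
      ≈⟨ solve 1 (λ Q → con 1ℙ :+ Q :* Q := (con 1ℙ :+ Q) :* (con 1ℙ :+ Q)) R.refl (split i j) ⟩
    S * S                        ∎
  S∣1 : S ∣ 1#
  S∣1 = [ id , id ]′ (factor M≈S²)
  S²∣1 : S * S ∣ 1#
  S²∣1 = ∣ʳ-reflexive (R.trans (R.*-cong (∣1⇒≈1 S∣1) (∣1⇒≈1 S∣1)) (R.*-identityˡ 1#))
... | nonSquare A i j e n≡ = (1# + A) , i , j , (begin
    M                                            ≈⟨ M≈ ⟩
    1# + split a b                               ≈⟨ R.+-congˡ {1#} e ⟩
    1# + (A * A + X * (split i j * split i j))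
      ≈⟨ solve 2 (λ A z → con 1ℙ :+ (A :* A :+ z) := (con 1ℙ :+ A) :* (con 1ℙ :+ A) :+ z)
           R.refl A (X * (split i j * split i j)) ⟩
    (1# + A) * (1# + A) + X * (split i j * split i j) ∎)
  , subst (λ d → d ≡ _ ⊎ d ≡ _) (≡.sym (degree-monic (monic-mersenne 1≤a M≈))) n≡

-- Squarefreeness of geometric sums

geometric-telescopes : ∀ M n → (1# + M) * geometric M n ≈ 1# + M ^ n
geometric-telescopes M zero    = begin
  (1# + M) * 0#  ≈⟨ R.zeroʳ (1# + M) ⟩
  0#             ≈⟨ f+f≈0 1# ⟨
  1# + 1#        ∎
geometric-telescopes M (suc n) = begin
  (1# + M) * (1# + M * geometric M n)
    ≈⟨ solve 2 (λ M g → (con 1ℙ :+ M) :* (con 1ℙ :+ M :* g)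
                      := con 1ℙ :+ M :+ M :* ((con 1ℙ :+ M) :* g))
         R.refl M (geometric M n) ⟩
  1# + M + M * ((1# + M) * geometric M n)
    ≈⟨ R.+-congˡ {1# + M} (R.*-congˡ {M} (geometric-telescopes M n)) ⟩
  1# + M + M * (1# + M ^ n)
    ≈⟨ solve 2 (λ M p → con 1ℙ :+ M :+ M :* (con 1ℙ :+ p) := con 1ℙ :+ M :* p) R.refl M (M ^ n) ⟩
  1# + M * M ^ n ∎

∤-degree : ∀ {P f n} → Monic f n → n < degree P → P ∤ f
∤-degree mf n<P P∣f = ℕₚ.<⇒≱ n<P
  (ℕₚ.≤-trans (∣⇒degree≤ (monic⇒≉0 mf) P∣f) (ℕₚ.≤-reflexive (degree-monic mf)))

∤-split : ∀ {P} → Irreducible P → 2 ≤ degree P → ∀ i j → P ∤ split i j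
∤-split {P} irr 2≤P i j P∣Q = ∤-degree monic-X+1 2≤P (∣-^⇒∣ irr (X + 1#) j
  (euclid irr (X ^ i) ((X + 1#) ^ j) (λ P∣X^i → ∤-degree monic-X 2≤P (∣-^⇒∣ irr X i P∣X^i)) P∣Q))

-- The derivative argument (P² ∣ Mⁿ + 1 with n odd forces P ∣ M′), carried out by
-- comparing odd parts.
geometric-squarefree : ∀ {P M} → MersennePrime M → Irreducible P → 2 ≤ degree P → ∀ h →
  P * P ∤ geometric M (suc (h ℕ.+ h))
geometric-squarefree {P} {M} mers irr 2≤P h P²∣G
  with A , i , j , M≈ , _ ← mersenne-parts mers
  with q , e ← ∣ʳ-trans P²∣G (x∣ʳyx (geometric M (suc (h ℕ.+ h))) (1# + M))
  with C , D , q≈ ← even-odd-parts q =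
  -- The odd part of `q * (P * P)` is `D * P`, and that of `1# + M * (K * K)` is `K * Q`. So `P`
  -- divides `K * Q`, hence `Q`.
  ∤-split irr 2≤P i j (euclid irr K Q P∤K
    (D , odd-part-unique (C * P) (D * P) (1# + A * K) (K * Q) parts))
  where
  K = M ^ h
  Q = split i j

  1+MK²≈qP² : 1# + M * (K * K) ≈ q * (P * P)
  1+MK²≈qP² = begin
    1# + M * (K * K)          ≈⟨ R.+-congˡ {1#} (R.*-congˡ {M} (^-homo-* M h h)) ⟨
    1# + M ^ suc (h ℕ.+ h)    ≈⟨ geometric-telescopes M (suc (h ℕ.+ h)) ⟨
    (1# + M) * geometric M (suc (h ℕ.+ h)) ≈⟨ e ⟨
    q * (P * P)               ∎

  parts : C * P * (C * P) + X * (D * P * (D * P)) ≈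
          (1# + A * K) * (1# + A * K) + X * (K * Q * (K * Q))
  parts = begin
    C * P * (C * P) + X * (D * P * (D * P))
      ≈⟨ solve 4 (λ C D P x → C :* P :* (C :* P) :+ x :* (D :* P :* (D :* P))
           := (C :* C :+ x :* (D :* D)) :* (P :* P)) R.refl C D P X ⟩
    (C * C + X * (D * D)) * (P * P)   ≈⟨ R.*-congʳ {P * P} q≈ ⟨
    q * (P * P)                       ≈⟨ 1+MK²≈qP² ⟨
    1# + M * (K * K)                  ≈⟨ R.+-congˡ {1#} (R.*-congʳ {K * K} M≈) ⟩
    1# + (A * A + X * (Q * Q)) * (K * K)
      ≈⟨ solve 4 (λ A Q K x → con 1ℙ :+ (A :* A :+ x :* (Q :* Q)) :* (K :* K)
           := (con 1ℙ :+ A :* K) :* (con 1ℙ :+ A :* K) :+ x :* (K :* Q :* (K :* Q))) R.refl A Q K X ⟩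
    (1# + A * K) * (1# + A * K) + X * (K * Q * (K * Q)) ∎

  P∤M : P ∤ M
  P∤M P∣M = Irreducible.p∤1 irr (∣ʳ-respʳ-≈
    (solve 1 (λ z → con 1ℙ :+ z :+ z := con 1ℙ) R.refl (M * (K * K)))
    (∣-+ (∣ʳ-respʳ-≈ (R.sym 1+MK²≈qP²) (∣ʳ-trans (x∣xy P P) (x∣ʳyx (P * P) q)))
         (∣ʳ-trans P∣M (x∣xy M (K * K)))))

  P∤K : P ∤ K
  P∤K P∣K = P∤M (∣-^⇒∣ irr M h P∣K)

-- Both exponents are at most `degree P`, so a bounded search decides.
mersenne? : ∀ {P} → Irreducible P → Dec (MersennePrime P)
mersenne? {P} irr = map′
  (λ { (a , _ , b , _ , 1≤a , 1≤b , e) → irr , a , b , 1≤a , 1≤b , e })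
  (λ { (_ , a , b , 1≤a , 1≤b , e) →
       let deg = degree-monic (monic-mersenne 1≤a e) in
       a , s≤s (ℕₚ.≤-trans (ℕₚ.m≤m+n a b) (ℕₚ.≤-reflexive (≡.sym deg))) ,
       b , s≤s (ℕₚ.≤-trans (ℕₚ.m≤n+m b a) (ℕₚ.≤-reflexive (≡.sym deg))) , 1≤a , 1≤b , e })
  (ℕₚ.anyUpTo? (λ a → ℕₚ.anyUpTo? (λ b →
    (1 ℕ.≤? a) ×-dec (1 ℕ.≤? b) ×-dec (P ≈? 1# + X ^ a * (X + 1#) ^ b))
    (suc (degree P))) (suc (degree P)))

-- Factorisation into Mersenne primes

HasNonMersenneFactor : Poly → Set
HasNonMersenneFactor F = ∃ λ P → Irreducible P × ¬ MersennePrime P × P ∣ F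

-- The second component says that F and σ F agree in their two top coefficients.
SplitSigma : Poly → Set
SplitSigma F = ∃₂ λ u v → σ F ≈ split u v × Bounded (X * (X * (F + split u v))) (u ℕ.+ v)

splitSigma-1 : ∀ {F} → F ≈ 1# → SplitSigma F
splitSigma-1 {F} F≈1 = 0 , 0 , R.trans (σ-1 F≈1) (R.sym (R.*-identityˡ 1#)) ,
  bounded-resp {0#} (R.sym vanishes) (λ _ _ → refl)
  where
  vanishes : X * (X * (F + 1# * 1#)) ≈ 0#
  vanishes = begin
    X * (X * (F + 1# * 1#))   ≈⟨ R.*-congˡ {X} (R.*-congˡ {X} (R.+-congʳ {1# * 1#} F≈1)) ⟩
    X * (X * (1# + 1# * 1#))
      ≈⟨ solve 1 (λ x → x :* (x :* (con 1ℙ :+ con 1ℙ :* con 1ℙ)) := con 0ℙ) R.refl X ⟩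
    const 0ℙ                  ≈⟨ 0∷0≈0 ⟩
    0#                        ∎

-- With `P ≈ 1# + V`, the error `F + V * T` is `T + (G + T) + V * (G + T)`. The factors `X * X`
-- express a degree bound lowered by 2 without subtraction: the last two terms inherit it from
-- `low`, and for `T` it holds because `a + b` is at least 2.
splitSigma-* : ∀ {F P G} → MersennePrime P → G ≉ 0# → P ∤ G → P * G ≈ F →
  SplitSigma G → SplitSigma F
splitSigma-* {F} {P} {G} (irr , a , b , 1≤a , 1≤b , P≈) G≉0 P∤G PG≈F (u , v , σG≈ , low) =
  a ℕ.+ u , b ℕ.+ v , σF≈ , bounded-resp {sum} sum≈ bounded-sum
  where
  V = split a b
  T = split u v
  L = X * (X * (G + T))
  sum = X * (X * T) + (L + V * L)

  degrees : a ℕ.+ b ℕ.+ (u ℕ.+ v) ≡ a ℕ.+ u ℕ.+ (b ℕ.+ v)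
  degrees = solveℕ 4 (λ a b u v → a :+ℕ b :+ℕ (u :+ℕ v) :=ℕ a :+ℕ u :+ℕ (b :+ℕ v)) refl a b u v

  σF≈ : σ F ≈ split (a ℕ.+ u) (b ℕ.+ v)
  σF≈ = begin
    σ F                 ≈⟨ σ-cong (*-≉0 (irreducible⇒≉0 irr) G≉0) PG≈F ⟨
    σ (P * G)           ≈⟨ σ-* irr G≉0 P∤G ⟩
    (1# + P) * σ G      ≈⟨ R.*-cong (R.+-congˡ {1#} P≈) σG≈ ⟩
    (1# + (1# + V)) * T
      ≈⟨ solve 2 (λ V T → (con 1ℙ :+ (con 1ℙ :+ V)) :* T := V :* T) R.refl V T ⟩
    V * T               ≈⟨ split-* a b u v ⟩
    split (a ℕ.+ u) (b ℕ.+ v) ∎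

  sum≈ : sum ≈ X * (X * (F + split (a ℕ.+ u) (b ℕ.+ v)))
  sum≈ = begin
    X * (X * T) + (X * (X * (G + T)) + V * (X * (X * (G + T))))
      ≈⟨ solve 4 (λ x T V G → x :* (x :* T) :+ (x :* (x :* (G :+ T)) :+ V :* (x :* (x :* (G :+ T))))
           := x :* (x :* ((con 1ℙ :+ V) :* G :+ V :* T))) R.refl X T V G ⟩
    X * (X * ((1# + V) * G + V * T))
      ≈⟨ R.*-congˡ {X} (R.*-congˡ {X}
           (R.+-cong (R.trans (R.*-congʳ {G} (R.sym P≈)) PG≈F) (split-* a b u v))) ⟩
    X * (X * (F + split (a ℕ.+ u) (b ℕ.+ v))) ∎

  bounded-sum : Bounded sum (a ℕ.+ u ℕ.+ (b ℕ.+ v))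
  bounded-sum = subst (Bounded sum) degrees
    (bounded-+ {X * (X * T)} {L + V * L}
      (bounded-mono {X * (X * T)} (ℕₚ.+-monoˡ-≤ (u ℕ.+ v) (ℕₚ.+-mono-≤ 1≤a 1≤b))
        (bounded (monic-* monic-X (monic-* monic-X (monic-split u v)))))
      (bounded-+ {L} {V * L}
        (bounded-mono {L} (ℕₚ.m≤n+m (u ℕ.+ v) (a ℕ.+ b)) low)
        (bounded-* {V} {L} (bounded (monic-split a b)) low)))

-- Stripping off a Mersenne factor `P` leaves, by squarefreeness, a cofactor not divisible by `P`,
-- as `σ-*` requires. Any other irreducible factor ends the search at once.
factor-or-splitSigma : ∀ n F → F ≉ 0# → degree F < n →
  (∀ P → MersennePrime P → P * P ∤ F) → HasNonMersenneFactor F ⊎ SplitSigma F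
factor-or-splitSigma (suc n) F F≉0 (s≤s F≤n) sqfree with F ≈? 1#
... | yes F≈1 = inj₂ (splitSigma-1 F≈1)
... | no  F≉1 with ∃-irreducible-factor _ F F≉0 F≉1 (ℕₚ.n<1+n _)
...   | P , irr , P∣F@(G , GP≈F) with mersenne? irr
...     | no  ¬mers = inj₁ (P , irr , ¬mers , P∣F)
...     | yes mers  = combine (factor-or-splitSigma n G G≉0 (ℕₚ.<-≤-trans G<F F≤n)
                        λ P′ mers′ d → sqfree P′ mers′ (∣ʳ-trans d G∣F))
  where
  PG≈F : P * G ≈ F
  PG≈F = R.trans (R.*-comm P G) GP≈F

  G∣F : G ∣ F
  G∣F = P , PG≈F

  G≉0 : G ≉ 0#
  G≉0 = x∣y∧y≉0⇒x≉0 G∣F F≉0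

  P∤G : P ∤ G
  P∤G P∣G = sqfree P mers (∣ʳ-respʳ-≈ GP≈F (x∣ʳy⇒xz∣ʳyz P P∣G))

  G<F : degree G < degree F
  G<F = ℕₚ.<-≤-trans (ℕₚ.m<n+m (degree G) (ℕₚ.≤-trans z<s (degree-mersenne mers)))
    (ℕₚ.≤-reflexive (≡.trans (≡.sym (degree-* P G (≉-resp (R.sym PG≈F) F≉0))) (degree-cong PG≈F)))

  combine : HasNonMersenneFactor G ⊎ SplitSigma G → HasNonMersenneFactor F ⊎ SplitSigma F
  combine (inj₁ (P′ , irr′ , ¬mers′ , P′∣G)) = inj₁ (P′ , irr′ , ¬mers′ , ∣ʳ-trans P′∣G G∣F)
  combine (inj₂ s) = inj₂ (splitSigma-* mers G≉0 P∤G PG≈F s)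

-- Top coefficients

module _ {F n u v} (mF : Monic F (suc n)) (F-second : coeff F n ≡ 0ℙ)
         (low : Bounded (X * (X * (F + split u v))) (u ℕ.+ v)) where

  -- Removing the two factors `X` shifts the index by 2, so the agreement reaches down to
  -- `u + v - 1`, the second coefficient.
  coeff-agree : ∀ {k} → u ℕ.+ v < suc (suc k) → coeff F k ≡ coeff (split u v) k
  coeff-agree {k} lt = ℙₚ.+-cancelʳ-≡ (coeff (split u v) k) (coeff F k) _
    (≡.trans (≡.sym (coeff-+ F (split u v) k))
      (≡.trans vanishes (≡.sym (ℙₚ.p+p≡0ℙ (coeff (split u v) k)))))
    where
    vanishes : coeff (F + split u v) k ≡ 0ℙ
    vanishes = ≡.trans
      (≡.sym (≡.trans (coeff-X* (X * (F + split u v)) (suc k)) (coeff-X* (F + split u v) k)))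
      (low (suc (suc k)) lt)

  degree-agree : suc n ≡ u ℕ.+ v
  degree-agree = monic-unique mF (monic
    (λ k lt → ≡.trans (coeff-agree (ℕₚ.<-≤-trans lt (ℕₚ.m≤n+m k 2))) (bounded (monic-split u v) k lt))
    (≡.trans (coeff-agree (ℕₚ.m≤n+m _ 1)) (leading (monic-split u v))))

  -- The degree `suc n` is even, which excludes exactly one odd exponent. With two odd exponents the
  -- coefficient of `split u v` at `n` would be the leading one of its odd part, hence 1, whereas
  -- `F` has 0 there.
  split-isSquare : ℕ.parity n ≡ 1ℙ → ∃₂ λ i j → split u v ≈ split i j * split i j
  split-isSquare n-odd with splitParts u v
  ... | isSquare i j e = i , j , e
  ... | nonSquare A i j e (inj₁ u+v≡) = contradiction
    (≡.trans (≡.sym n-odd) (≡.trans (cong ℕ.parity (ℕₚ.suc-injective (≡.trans degree-agree u+v≡)))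
      (parity-double (i ℕ.+ j)))) λ ()
  ... | nonSquare A i j e (inj₂ u+v≡) = contradiction (≡.trans (≡.sym F-second) leading-odd) λ ()
    where
    m = i ℕ.+ j
    n≡ : n ≡ suc (m ℕ.+ m)
    n≡ = ℕₚ.suc-injective (≡.trans degree-agree u+v≡)
    leading-odd : coeff F n ≡ 1ℙ
    leading-odd = ≡.trans
      (coeff-agree (ℕₚ.≤-trans (ℕₚ.≤-reflexive (cong suc (≡.sym degree-agree))) ℕₚ.≤-refl))
      (≡.trans (cong (coeff (split u v)) n≡)
        (≡.trans (coeff-≈ e _) (≡.trans (coeff-odd-part A (split i j) m) (leading (monic-split i j)))))

-- `geometric` unfolds at the constant term; degree estimates need the top term split off.
geometric-suc : ∀ M n → geometric M (suc n) ≈ M ^ n + geometric M n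
geometric-suc M zero    = R.+-congˡ {1#} (R.zeroʳ M)
geometric-suc M (suc n) = begin
  1# + M * geometric M (suc n)        ≈⟨ R.+-congˡ {1#} (R.*-congˡ {M} (geometric-suc M n)) ⟩
  1# + M * (M ^ n + geometric M n)
    ≈⟨ solve 3 (λ M p g → con 1ℙ :+ M :* (p :+ g) := M :* p :+ (con 1ℙ :+ M :* g))
         R.refl M (M ^ n) (geometric M n) ⟩
  M ^ suc n + geometric M (suc n)     ∎

bounded-geometric : ∀ {M d} → Monic M d → ∀ n → Bounded (geometric M (suc n)) (n ℕ.* d)
bounded-geometric {M} m zero = bounded-resp {1#} (R.sym (geometric-suc M 0)) (bounded monic-1)
bounded-geometric {M} {d} m (suc n) =
  bounded-resp {M ^ suc n + geometric M (suc n)} (R.sym (geometric-suc M (suc n)))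
    (bounded-+ {M ^ suc n} {geometric M (suc n)} (bounded (monic-^ m (suc n)))
      (bounded-mono {geometric M (suc n)} (ℕₚ.m≤n+m (n ℕ.* d) d) (bounded-geometric m n)))

monic-geometric : ∀ {M d} → Monic M d → 0 < d → ∀ n → Monic (geometric M (suc n)) (n ℕ.* d)
monic-geometric {M} {d} m 0<d n = monic-resp (R.sym (geometric-suc M n)) (go n)
  where
  go : ∀ n → Monic (M ^ n + geometric M n) (n ℕ.* d)
  go zero    = monic-1
  go (suc n) = monic-+ (monic-^ m (suc n)) (bounded-geometric m n) (ℕₚ.m<n+m (n ℕ.* d) 0<d)

-- This index determines membership in `Σₚ`: it is the degree of `W` if that is odd, and
-- `degree W ∸ m` if it is even.
record OddTop (f : Poly) (n : ℕ) : Set where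
  field
    odd   : ℕ.parity n ≡ 1ℙ
    at    : coeff f n ≡ 1ℙ
    above : ∀ {k} → n < k → ℕ.parity k ≡ 1ℙ → coeff f k ≡ 0ℙ

open OddTop

-- `A * A` has no odd coefficients and `C` none above `n + n`, so from `suc (n + n)` on the odd
-- coefficients are those of `X * (B * B)`.
oddTop : ∀ {f} A B C {n c} → f ≈ A * A + X * (B * B) + C →
  Monic B n → Bounded C c → c ≤ n ℕ.+ n → OddTop f (suc (n ℕ.+ n))
oddTop {f} A B C {n} {c} e mB bC c≤ = record
  { odd   = ≡.trans (parity-suc (n ℕ.+ n)) (cong ℙ._⁻¹ (parity-double n))
  ; at    = ≡.trans (coeff-f ℕₚ.≤-refl (parity-double n)) (leading mB²)
  ; above = λ { {suc k} (s≤s lt) odd-k →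
      ≡.trans (coeff-f (ℕₚ.<⇒≤ lt) (ℙₚ.⁻¹-injective (≡.trans (≡.sym (parity-suc k)) odd-k)))
        (bounded mB² k lt) }
  }
  where
  mB² = monic-* mB mB

  coeff-f : ∀ {t} → n ℕ.+ n ≤ t → ℕ.parity t ≡ 0ℙ → coeff f (suc t) ≡ coeff (B * B) t
  coeff-f {t} n+n≤t even = ≡.trans (coeff-≈ e (suc t))
    (≡.trans (coeff-+ (A * A + X * (B * B)) C (suc t))
    (≡.trans (cong₂ ℙ._+_ (coeff-odd A B {t} even) (bC (suc t) (s≤s (ℕₚ.≤-trans c≤ n+n≤t))))
      (ℙₚ.+-identityʳ _)))

module _ {M d} (mM : Monic M d) (k : ℕ) where

  private
    h = suc k
    F = geometric M (suc (h ℕ.+ h))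
    -- `k + h = 2h - 1` terms, up to `M ^ (2h - 2)`: what remains below the two top terms.
    low = geometric M (k ℕ.+ h)

  bounded-low : Bounded low ((k ℕ.+ k) ℕ.* d)
  bounded-low = subst (λ n → Bounded (geometric M n) ((k ℕ.+ k) ℕ.* d)) (≡.sym (ℕₚ.+-suc k k))
    (bounded-geometric mM (k ℕ.+ k))

  geometric-top : F ≈ M ^ h * M ^ h + geometric M (h ℕ.+ h)
  geometric-top = R.trans (geometric-suc M (h ℕ.+ h))
    (R.+-congʳ {geometric M (h ℕ.+ h)} (^-homo-* M h h))

  -- The odd power `M ^ (k + h)` is `M` times a square, so its odd part is that of `M` times
  -- `M ^ k`.
  geometric-top₂ : geometric M (h ℕ.+ h) ≈ M ^ k * (M * M ^ k) + low
  geometric-top₂ = R.trans (geometric-suc M (k ℕ.+ h)) (R.+-congʳ {low} (^-homo-* M k h))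

  -- The second coefficient of `F` sits at `N′ = 2hd - 1`. The square `M ^ h * M ^ h` contributes
  -- nothing at this odd index, and the other terms have degree at most `2hd - d`, which is smaller
  -- because `d` is at least 2.
  splitSigma⇒square : 2 ≤ d → SplitSigma F → ∃₂ λ i j → σ F ≈ split i j * split i j
  splitSigma⇒square (s≤s (s≤s {n = d′} _)) (u , v , σF≈ , bd) =
    let i , j , e = split-isSquare {F} {N′} {u} {v} mF second bd N′-odd in i , j , R.trans σF≈ e
    where
    N′ = suc (d′ ℕ.+ (k ℕ.+ h) ℕ.* d)

    N′-odd : ℕ.parity N′ ≡ 1ℙ
    N′-odd = ℙₚ.⁻¹-injective (≡.trans (≡.sym (parity-suc N′))
      (≡.trans (ℙₚ.*-homo-* (h ℕ.+ h) d) (cong (ℙ._* ℕ.parity d) (parity-double h))))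

    tail = geometric M (h ℕ.+ h)
    bounded-tail : Bounded tail ((k ℕ.+ h) ℕ.* d)
    bounded-tail = bounded-geometric mM (k ℕ.+ h)

    mF : Monic F (suc N′)
    mF = monic-geometric mM z<s (h ℕ.+ h)

    second : coeff F N′ ≡ 0ℙ
    second = ≡.trans (coeff-≈ geometric-top N′) (≡.trans (coeff-+ (M ^ h * M ^ h) tail N′)
      (cong₂ ℙ._+_ (coeff-square-odd (M ^ h) {N′} N′-odd) (bounded-tail N′ (s≤s (ℕₚ.m≤n+m _ d′)))))

  W-oddTop : 0 < d → Irreducible M → ∀ {S A i j} → M ≈ A * A + X * (split i j * split i j) →
    σ F ≈ S * S → let n = i ℕ.+ j ℕ.+ k ℕ.* d in OddTop (W h M) (suc (n ℕ.+ n))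
  W-oddTop 0<d irr {S} {A} {i} {j} M≈ σF≈ = oddTop (S + K + A * L) (Q * L) (low + 1#) W≈
    (monic-* (monic-split i j) (monic-^ mM k))
    (bounded-+ {low} {1#} bounded-low (bounded-mono {1#} z≤n (bounded monic-1)))
    -- `low` has degree at most `2kd`, the square of `Q * L` has degree `2(i + j + kd)`.
    (ℕₚ.≤-trans (ℕₚ.≤-reflexive (ℕₚ.*-distribʳ-+ d k k))
      (ℕₚ.+-mono-≤ (ℕₚ.m≤n+m (k ℕ.* d) (i ℕ.+ j)) (ℕₚ.m≤n+m (k ℕ.* d) (i ℕ.+ j))))
    where
    K = M ^ h
    L = M ^ k
    Q = split i j

    σM≈F : σ (M ^ (2 ℕ.* h)) ≈ F
    σM≈F = subst (λ n → σ (M ^ (h ℕ.+ n)) ≈ F) (≡.sym (ℕₚ.+-identityʳ h)) (σ-^ irr (h ℕ.+ h))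

    F≉0 : F ≉ 0#
    F≉0 = monic⇒≉0 (monic-geometric mM 0<d (h ℕ.+ h))

    W≈ : W h M ≈ (S + K + A * L) * (S + K + A * L) + X * (Q * L * (Q * L)) + (low + 1#)
    W≈ = begin
      σ (σ (M ^ (2 ℕ.* h))) + σ (M ^ (2 ℕ.* h)) + 1#
        ≈⟨ R.+-congʳ {1#} (R.+-cong (R.trans (σ-cong (≉-resp (R.sym σM≈F) F≉0) σM≈F) σF≈) σM≈F) ⟩
      S * S + F + 1#
        ≈⟨ R.+-congʳ {1#} (R.+-congˡ {S * S} (R.trans geometric-top (R.+-congˡ {K * K}
             (R.trans geometric-top₂ (R.+-congʳ {low} (R.*-congˡ {L} (R.*-congʳ {L} M≈))))))) ⟩
      S * S + (K * K + (L * ((A * A + X * (Q * Q)) * L) + low)) + 1#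
        ≈⟨ solve 7 (λ S K L A x Q l →
             S :* S :+ (K :* K :+ (L :* ((A :* A :+ x :* (Q :* Q)) :* L) :+ l)) :+ con 1ℙ :=
             (S :+ K :+ A :* L) :* (S :+ K :+ A :* L) :+ x :* (Q :* L :* (Q :* L)) :+ (l :+ con 1ℙ))
             R.refl S K L A X Q low ⟩
      (S + K + A * L) * (S + K + A * L) + X * (Q * L * (Q * L)) + (low + 1#) ∎

-- Membership in Σₚ

even⇒2∣ : ∀ n → ℕ.parity n ≡ 0ℙ → 2 ℕ∣.∣ n
even⇒2∣ zero          _ = 2 ℕ∣.∣0
even⇒2∣ (suc (suc n)) e = ℕ∣.∣m∣n⇒∣m+n ℕ∣.∣-refl (even⇒2∣ n e)

odd⇒2∤ : ∀ n → ℕ.parity n ≡ 1ℙ → Odd n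
odd⇒2∤ _ e (ℕ∣.divides q refl) = contradiction
  (≡.trans (≡.sym e) (≡.trans (ℙₚ.*-homo-* q 2) (ℙₚ.*-zeroʳ (ℕ.parity q)))) λ ()

2∤⇒odd : ∀ n → Odd n → ℕ.parity n ≡ 1ℙ
2∤⇒odd n odd-n with ℕ.parity n in e
... | 0ℙ = contradiction (even⇒2∣ n e) odd-n
... | 1ℙ = refl

-- Integer divisibility is divisibility of absolute values, and a sign does not change parity; this
-- gives the parity of `c`.
parity-⊖ : ∀ m n → ℕ.parity ℤ.∣ m ⊖ n ∣ ≡ ℕ.parity m ℙ.+ ℕ.parity n
parity-⊖ zero    zero    = refl
parity-⊖ zero    (suc n) = refl
parity-⊖ (suc m) zero    = ≡.sym (ℙₚ.+-identityʳ _)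
parity-⊖ (suc m) (suc n)
  rewrite ℤₚ.[1+m]⊖[1+n]≡m⊖n m n | parity-suc m | parity-suc n
  with ℕ.parity m | ℕ.parity n | parity-⊖ m n
... | 0ℙ | 0ℙ | e = e
... | 0ℙ | 1ℙ | e = e
... | 1ℙ | 0ℙ | e = e
... | 1ℙ | 1ℙ | e = e

module _ {p M n} (mers : MersennePrime M) (top : OddTop (W ⌊ p /2⌋ M) n) where

  private
    h  = ⌊ p /2⌋
    w  = degree (W h M)
    N  = 2 ℕ.* h ℕ.* degree M

  W≉0 : W h M ≉ 0#
  W≉0 e = contradiction (≡.trans (≡.sym (at top)) (coeff-≈ e n)) λ ()

  n≤w : n ≤ w
  n≤w = ℕₚ.≮⇒≥ λ w<n → contradiction (≡.trans (≡.sym (at top)) (coeff>degree (W h M) n w<n)) λ ()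

  w-odd⇒w≡n : ℕ.parity w ≡ 1ℙ → w ≡ n
  w-odd⇒w≡n w-odd with ℕₚ.m≤n⇒m<n∨m≡n n≤w
  ... | inj₂ n≡w = ≡.sym n≡w
  ... | inj₁ n<w = contradiction
    (≡.trans (≡.sym (coeff-degree (W h M) W≉0)) (above top n<w w-odd)) λ ()

  private
    r = w ∸ n

    w≡n+r : w ≡ n ℕ.+ r
    w≡n+r = ≡.sym (ℕₚ.m+[n∸m]≡n n≤w)

  r-odd : ℕ.parity w ≡ 0ℙ → ℕ.parity r ≡ 1ℙ
  r-odd w-even with ℕ.parity r in e
  ... | 1ℙ = refl
  ... | 0ℙ = contradiction (≡.trans (≡.sym w-even) (≡.trans (cong ℕ.parity w≡n+r)
    (≡.trans (ℙₚ.+-homo-+ n r) (cong₂ ℙ._+_ (odd top) e)))) λ ()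

  -- For even `w` and odd `k`, `α k` looks at the odd index `w ∸ k`. Counted from the top, the first
  -- such index carrying a 1 is `n`.
  r-leastOddOne : ℕ.parity w ≡ 0ℙ → IsLeastOddOne h M r
  r-leastOddOne w-even =
    ( odd⇒2∤ r (r-odd w-even) , ℕₚ.m∸n≤m w n
    , ≡.trans (cong (coeff (W h M)) (ℕₚ.m∸[m∸n]≡n n≤w)) (at top)) , least
    where
    least : ∀ k → OddOneAt h M k → r ≤ k
    least k (k-odd , k≤w , αk≡1) = ℕₚ.≮⇒≥ λ k<r → contradiction
      (≡.trans (≡.sym αk≡1) (above top (n<w∸k k<r) w∸k-odd)) λ ()
      where
      n<w∸k : k < r → n < w ∸ k
      n<w∸k k<r = ℕₚ.m+n≤o⇒m≤o∸n (suc n) (subst (n ℕ.+ k <_) (≡.sym w≡n+r) (ℕₚ.+-monoʳ-< n k<r))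

      w∸k-odd : ℕ.parity (w ∸ k) ≡ 1ℙ
      w∸k-odd with ℕ.parity (w ∸ k) in e
      ... | 1ℙ = refl
      ... | 0ℙ = contradiction (≡.trans (≡.sym w-even) (≡.trans (cong ℕ.parity (≡.sym (ℕₚ.m∸n+n≡m k≤w)))
        (≡.trans (ℙₚ.+-homo-+ (w ∸ k) k) (cong₂ ℙ._+_ e (2∤⇒odd k k-odd))))) λ ()

  -- `c = N - w` and `r = w - n` telescope to `N - n`.
  c+r : ∀ {e} → n ℕ.+ e ≡ N → c h M ℤ.+ + r ≡ + e
  c+r {e} n+e≡N = ≡.trans (cong (λ c → c ℤ.+ + r) (≡.trans
      (cong₂ _⊖_ (≡.sym n+e≡N) w≡n+r) (ℤₚ.+-cancelˡ-⊖ n e r)))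
    (≡.trans (ℤₚ.distribˡ-⊖-+-pos r e r)
      (≡.trans (ℤₚ.⊖-≥ (ℕₚ.m≤n+m r e)) (cong +_ (ℕₚ.m+n∸n≡m e r))))

  w-odd⇒c : ℕ.parity w ≡ 1ℙ → ∀ {e} → n ℕ.+ e ≡ N → c h M ≡ + e
  w-odd⇒c w-odd n+e≡N = ≡.trans (≡.sym (ℤₚ.+-identityʳ (c h M)))
    (≡.trans (cong (λ r → c h M ℤ.+ + r)
      (≡.sym (≡.trans (cong (_∸ n) (w-odd⇒w≡n w-odd)) (ℕₚ.n∸n≡0 n))))
      (c+r n+e≡N))

  parity-c : ℕ.parity ℤ.∣ c h M ∣ ≡ ℕ.parity w
  parity-c = ≡.trans (parity-⊖ N w) (cong (ℙ._+ ℕ.parity w)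
    (≡.trans (ℙₚ.*-homo-* (2 ℕ.* h) (degree M)) (cong (ℙ._* ℕ.parity (degree M)) (ℙₚ.*-homo-* 2 h))))

  ∈Σₚ : n ℕ.+ degree M ≡ N ⊎ n ℕ.+ (degree M ℕ.+ 1) ≡ N → Σₚ p M
  ∈Σₚ e with ℕ.parity w in w-parity
  ∈Σₚ (inj₁ e) | 1ℙ = inj₁ (mers , W≉0 , w-odd⇒c w-parity e)
  ∈Σₚ (inj₂ e) | 1ℙ = inj₂ (inj₁
    (mers , W≉0 , w-odd⇒c w-parity e , odd⇒2∤ _ (≡.trans parity-c w-parity)))
  ∈Σₚ (inj₁ e) | 0ℙ = inj₂ (inj₂ (inj₁
    (mers , W≉0 , even⇒2∣ _ (≡.trans parity-c w-parity) , r , r-leastOddOne w-parity , c+r e)))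
  ∈Σₚ (inj₂ e) | 0ℙ with r in r≡ | r-leastOddOne w-parity | c+r e
  ... | 0 | least | _ = contradiction (2 ℕ∣.∣0) (proj₁ (proj₁ least))
  -- `Σ⁴` excludes `m = 1`, but cancelling the 1 leaves `c ≡ degree M`, which is `Σ¹`.
  ... | 1 | least | c+1 = inj₁ (mers , W≉0 , Groupₚ.∙-cancelʳ
    (CommutativeRing.+-group ℤₚ.+-*-commutativeRing) (+ 1) (c h M) (+ degree M) c+1)
  ... | 2 | least | _ = contradiction ℕ∣.∣-refl (proj₁ (proj₁ least))
  ... | suc (suc (suc r′)) | least | c+r≡ = inj₂ (inj₂ (inj₂
    (mers , W≉0 , even⇒2∣ _ (≡.trans parity-c w-parity) , _ , least , c+r≡ , s≤s (s≤s (s≤s z≤n)))))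

prime-odd : ∀ {p} → Prime p → p ≥ 5 → ∃ λ k → p ≡ suc (suc k ℕ.+ suc k)
prime-odd {p} pr p≥5 with half p
... | zero  , inj₁ refl with () ← p≥5
... | zero  , inj₂ refl with s≤s () ← p≥5
... | suc k , inj₂ e = k , e
... | suc k , inj₁ e with prime⇒irreducible pr
      (even⇒2∣ p (≡.trans (cong ℕ.parity e) (parity-double (suc k))))
...   | inj₂ refl with s≤s (s≤s ()) ← p≥5

⌊1+n+n/2⌋≡n : ∀ n → ⌊ suc (n ℕ.+ n) /2⌋ ≡ n
⌊1+n+n/2⌋≡n zero    = refl
⌊1+n+n/2⌋≡n (suc n) = cong suc (≡.trans (cong ⌊_/2⌋ (ℕₚ.+-suc n n)) (⌊1+n+n/2⌋≡n n))

-- The origin of `e`: subtracting the top odd index `1 + 2(m + kd)` from `2(k + 1)d` leaves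
-- `2d - 2m - 1`, which is `d` or `d + 1` according as `d - 2m` is 1 or 2.
top-degree-odd : ∀ m k {d} → d ≡ suc (m ℕ.+ m) →
  suc (m ℕ.+ k ℕ.* d ℕ.+ (m ℕ.+ k ℕ.* d)) ℕ.+ d ≡ 2 ℕ.* suc k ℕ.* d
top-degree-odd m k refl = solveℕ 2 (λ m k → let d = conℕ 1 :+ℕ (m :+ℕ m) in
  conℕ 1 :+ℕ (m :+ℕ k :*ℕ d :+ℕ (m :+ℕ k :*ℕ d)) :+ℕ d
    :=ℕ conℕ 2 :*ℕ (conℕ 1 :+ℕ k) :*ℕ d) refl m k

top-degree-even : ∀ m k {d} → d ≡ suc (suc (m ℕ.+ m)) →
  suc (m ℕ.+ k ℕ.* d ℕ.+ (m ℕ.+ k ℕ.* d)) ℕ.+ (d ℕ.+ 1) ≡ 2 ℕ.* suc k ℕ.* d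
top-degree-even m k refl = solveℕ 2 (λ m k → let d = conℕ 2 :+ℕ (m :+ℕ m) in
  conℕ 1 :+ℕ (m :+ℕ k :*ℕ d :+ℕ (m :+ℕ k :*ℕ d)) :+ℕ (d :+ℕ conℕ 1)
    :=ℕ conℕ 2 :*ℕ (conℕ 1 :+ℕ k) :*ℕ d) refl m k

splitSigma⇒∈Σₚ : ∀ {p M} k → ⌊ p /2⌋ ≡ suc k → MersennePrime M →
  SplitSigma (geometric M (suc (suc k ℕ.+ suc k))) → Σₚ p M
splitSigma⇒∈Σₚ {p} {M} k h≡ mers s
  with A , i , j , M≈ , deg ← mersenne-parts mers
     | a , b , σ≈ ← splitSigma⇒square (monic-degree (irreducible⇒≉0 (proj₁ mers))) k
                      (degree-mersenne mers) s =
  let n = i ℕ.+ j ℕ.+ k ℕ.* degree M in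
  ∈Σₚ {p} mers (subst (λ h → OddTop (W h M) (suc (n ℕ.+ n))) (≡.sym h≡)
      (W-oddTop (monic-degree (irreducible⇒≉0 (proj₁ mers))) k
        (ℕₚ.≤-trans z<s (degree-mersenne mers)) (proj₁ mers)
        {split a b} {A} {i} {j} M≈ σ≈))
    (Sum.map (λ d≡ → ≡.trans (top-degree-odd (i ℕ.+ j) k d≡) 2h≡)
             (λ d≡ → ≡.trans (top-degree-even (i ℕ.+ j) k d≡) 2h≡) deg)
  where
  2h≡ : 2 ℕ.* suc k ℕ.* degree M ≡ 2 ℕ.* ⌊ p /2⌋ ℕ.* degree M
  2h≡ = cong (λ h → 2 ℕ.* h ℕ.* degree M) (≡.sym h≡)

geometric-hasNonMersenneFactor : ∀ {p M} k → p ≡ suc (suc k ℕ.+ suc k) →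
  MersennePrime M → M ∉ Σₚ p → HasNonMersenneFactor (geometric M p)
geometric-hasNonMersenneFactor {p} {M} k refl mers M∉Σ =
  [ id
  , (λ s → contradiction (splitSigma⇒∈Σₚ {p} k (⌊1+n+n/2⌋≡n (suc k)) mers s) M∉Σ) ]′
  (factor-or-splitSigma _ (geometric M p)
    (monic⇒≉0 (monic-geometric (monic-degree (irreducible⇒≉0 (proj₁ mers)))
      (ℕₚ.≤-trans z<s (degree-mersenne mers)) (suc k ℕ.+ suc k)))
    (ℕₚ.n<1+n _)
    (λ P mersP → geometric-squarefree mers (proj₁ mersP) (degree-mersenne mersP) (suc k)))

-- The cyclotomic polynomial φ p

⟨⟩-zero : ∀ f g → f ≈ 0# → f ⟨ g ⟩ ≈ 0#
⟨⟩-zero []      g e = R.refl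
⟨⟩-zero (a ∷ f) g e = begin
  const a + g * f ⟨ g ⟩
    ≈⟨ R.+-cong {u = g * f ⟨ g ⟩} (∷-cong {g = []} (coeff-≈ e 0) R.refl)
         (R.*-congˡ {g} (⟨⟩-zero f g (coeffwise λ n → coeff-≈ e (suc n)))) ⟩
  const 0ℙ + g * 0#
    ≈⟨ R.+-cong 0∷0≈0 (R.zeroʳ g) ⟩
  0# ∎

-- `φ p` comes out of long division and is known only coefficientwise, so evaluation must respect
-- `≈`.
⟨⟩-congˡ : ∀ {f f′} g → f ≈ f′ → f ⟨ g ⟩ ≈ f′ ⟨ g ⟩
⟨⟩-congˡ {[]}    {f′}     g e = R.sym (⟨⟩-zero f′ g (R.sym e))
⟨⟩-congˡ {a ∷ f} {[]}     g e = ⟨⟩-zero (a ∷ f) g e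
⟨⟩-congˡ {a ∷ f} {b ∷ f′} g e = R.+-cong (∷-cong {g = []} (coeff-≈ e 0) R.refl)
  (R.*-congˡ {g} (⟨⟩-congˡ {f} {f′} g (coeffwise λ n → coeff-≈ e (suc n))))

∑-powers : ∀ M n → ∑ {n} (λ i → M ^ toℕ i) ≈ geometric M n
∑-powers M zero    = R.refl
∑-powers M (suc n) = R.+-congˡ {1#} (R.trans
  (R.sym (Sumₚ.*-distribˡ-sum R.semiring {n} M (λ i → M ^ toℕ i)))
  (R.*-congˡ {M} (∑-powers M n)))

-- Integer coefficients and division by X - 1

coeffℤ-+ : ∀ f g n → ℤ[x].coeff (f ℤ[x].+ g) n ≡ ℤ[x].coeff f n ℤ.+ ℤ[x].coeff g n
coeffℤ-+ []      g       n       = ≡.sym (ℤₚ.+-identityˡ _)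
coeffℤ-+ (a ∷ f) []      n       = ≡.sym (ℤₚ.+-identityʳ _)
coeffℤ-+ (a ∷ f) (b ∷ g) zero    = refl
coeffℤ-+ (a ∷ f) (b ∷ g) (suc n) = coeffℤ-+ f g n

coeffℤ-· : ∀ a f n → ℤ[x].coeff (a ℤ[x].· f) n ≡ a ℤ.* ℤ[x].coeff f n
coeffℤ-· a []      n       = ≡.sym (ℤₚ.*-zeroʳ a)
coeffℤ-· a (b ∷ f) zero    = refl
coeffℤ-· a (b ∷ f) (suc n) = coeffℤ-· a f n

coeffℤ-X*-zero : ∀ f → ℤ[x].coeff (ℤ[x].X ℤ[x].* f) 0 ≡ + 0
coeffℤ-X*-zero f = ≡.trans (coeffℤ-+ (+ 0 ℤ[x].· f) _ 0) (≡.trans (ℤₚ.+-identityʳ _)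
  (≡.trans (coeffℤ-· (+ 0) f 0) (ℤₚ.*-zeroˡ (ℤ[x].coeff f 0))))

coeffℤ-X*-suc : ∀ f n → ℤ[x].coeff (ℤ[x].X ℤ[x].* f) (suc n) ≡ ℤ[x].coeff f n
coeffℤ-X*-suc f n = ≡.trans (coeffℤ-+ (+ 0 ℤ[x].· f) _ (suc n)) (≡.trans
  (cong₂ ℤ._+_ (≡.trans (coeffℤ-· (+ 0) f (suc n)) (ℤₚ.*-zeroˡ (ℤ[x].coeff f (suc n)))) 1*f)
  (ℤₚ.+-identityˡ _))
  where
  0∷[] : ∀ n → ℤ[x].coeff (+ 0 ∷ []) n ≡ + 0
  0∷[] zero    = refl
  0∷[] (suc n) = refl

  1*f : ℤ[x].coeff (ℤ[x].1# ℤ[x].* f) n ≡ ℤ[x].coeff f n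
  1*f = ≡.trans (coeffℤ-+ (+ 1 ℤ[x].· f) (+ 0 ∷ []) n)
    (≡.trans (cong₂ ℤ._+_ (≡.trans (coeffℤ-· (+ 1) f n) (ℤₚ.*-identityˡ (ℤ[x].coeff f n))) (0∷[] n))
      (ℤₚ.+-identityʳ _))

-- The coefficients of X ^ k and of 1 + X + ⋯ + X ^ (k ∸ 1).
monomial-coeff below-coeff : ℕ → ℕ → ℤ
monomial-coeff zero    zero    = + 1
monomial-coeff zero    (suc n) = + 0
monomial-coeff (suc k) zero    = + 0
monomial-coeff (suc k) (suc n) = monomial-coeff k n

below-coeff zero    n       = + 0
below-coeff (suc k) zero    = + 1
below-coeff (suc k) (suc n) = below-coeff k n

coeffℤ-X^ : ∀ k n → ℤ[x].coeff (ℤ[x].X ℤ[x].^ k) n ≡ monomial-coeff k n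
coeffℤ-X^ zero    zero    = refl
coeffℤ-X^ zero    (suc n) = refl
coeffℤ-X^ (suc k) zero    = coeffℤ-X*-zero (ℤ[x].X ℤ[x].^ k)
coeffℤ-X^ (suc k) (suc n) = ≡.trans (coeffℤ-X*-suc (ℤ[x].X ℤ[x].^ k) n) (coeffℤ-X^ k n)

coeffℤ-X^-1 : ∀ k n → ℤ[x].coeff (ℤ[x].X ℤ[x].^ suc k ℤ[x].- ℤ[x].1#) (suc n) ≡ monomial-coeff k n
coeffℤ-X^-1 k n = ≡.trans (coeffℤ-+ (ℤ[x].X ℤ[x].^ suc k) (ℤ[x].- ℤ[x].1#) (suc n))
  (≡.trans (ℤₚ.+-identityʳ _) (coeffℤ-X^ (suc k) (suc n)))

-- Division by g = X - 1, of which only the constant term and the degree matter: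
-- the remainder of f is f(1), and the coefficients of the quotient are the values
-- at 1 of the tails of f.
module _ {g₁ : ℤ[x].Poly} (degree-g : ℤ[x].degree (ℤ.- + 1 ∷ g₁) ≡ 1) where

  private
    g : ℤ[x].Poly
    g = ℤ.- + 1 ∷ g₁

    remainder₀ : ℤ[x].Poly → ℤ
    remainder₀ f = ℤ[x].coeff (proj₂ (ℤ[x].divMod f g)) 0

  quotient-zero : ∀ a f → ℤ[x].coeff ((a ∷ f) ℤ[x]./ₘ g) 0 ≡ remainder₀ f
  quotient-zero a f rewrite degree-g = refl

  -- The quotient digit is the constant term of the previous remainder; subtracting it times `-1`
  -- adds it to `a`, which is Horner's rule at 1.
  remainder₀-∷ : ∀ a f → remainder₀ (a ∷ f) ≡ a ℤ.+ remainder₀ f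
  remainder₀-∷ a f rewrite degree-g = cong (ℤ._+_ a) (≡.trans
    (ℤₚ.neg-distribʳ-* (remainder₀ f) (ℤ.- + 1)) (ℤₚ.*-identityʳ (remainder₀ f)))

  divMod-vanish : ∀ f → (∀ n → ℤ[x].coeff f n ≡ + 0) →
    remainder₀ f ≡ + 0 × (∀ n → ℤ[x].coeff (f ℤ[x]./ₘ g) n ≡ + 0)
  divMod-vanish []      v = refl , λ _ → refl
  divMod-vanish (a ∷ f) v with r≡0 , q≡0 ← divMod-vanish f (λ n → v (suc n)) =
    ≡.trans (remainder₀-∷ a f) (cong₂ ℤ._+_ (v 0) r≡0)
    , λ { zero → ≡.trans (quotient-zero a f) r≡0 ; (suc n) → q≡0 n }

  divMod-monomial : ∀ k f → (∀ n → ℤ[x].coeff f n ≡ monomial-coeff k n) →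
    remainder₀ f ≡ + 1 × (∀ n → ℤ[x].coeff (f ℤ[x]./ₘ g) n ≡ below-coeff k n)
  divMod-monomial zero    []      e with () ← e 0
  divMod-monomial (suc k) []      e =
    contradiction (≡.trans (proj₁ (divMod-monomial k [] (λ n → e (suc n)))) refl) λ ()
  divMod-monomial zero    (a ∷ f) e with r≡0 , q≡0 ← divMod-vanish f (λ n → e (suc n)) =
    ≡.trans (remainder₀-∷ a f) (cong₂ ℤ._+_ (e 0) r≡0)
    , λ { zero → ≡.trans (quotient-zero a f) r≡0 ; (suc n) → q≡0 n }
  divMod-monomial (suc k) (a ∷ f) e with r≡1 , q≡ ← divMod-monomial k f (λ n → e (suc n)) =
    ≡.trans (remainder₀-∷ a f) (cong₂ ℤ._+_ (e 0) r≡1)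
    , λ { zero → ≡.trans (quotient-zero a f) r≡1 ; (suc n) → q≡ n }

  -- The constant term of the dividend enters only the remainder, so only the tail of `f` is
  -- constrained; for `X ^ suc k - 1` that tail is the monomial `X ^ k`.
  quotient-X^-1 : ∀ k f → (∀ n → ℤ[x].coeff f (suc n) ≡ monomial-coeff k n) →
    ∀ n → ℤ[x].coeff (f ℤ[x]./ₘ g) n ≡ below-coeff (suc k) n
  quotient-X^-1 k [] e = contradiction (proj₁ (divMod-monomial k [] e)) λ ()
  quotient-X^-1 k (a ∷ f) e with r≡1 , q≡ ← divMod-monomial k f e =
    λ { zero → ≡.trans (quotient-zero a f) r≡1 ; (suc n) → q≡ n }

cyclotomics≤-prime : ∀ {p} → Prime p → ∀ n → suc n < p →
  filter (λ (d , _) → d ℕ∣.∣? p) (cyclotomics≤ (suc n)) ≡ (1 , cyclotomic 1) ∷ []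
cyclotomics≤-prime {p} pr zero    lt =
  filter-accept (λ (d , _) → d ℕ∣.∣? p) {x = 1 , cyclotomic 1} {xs = []} (ℕ∣.1∣ p)
cyclotomics≤-prime {p} pr (suc n) lt = ≡.trans
  (filter-reject (λ (d , _) → d ℕ∣.∣? p)
    {x = suc (suc n) , cyclotomic (suc (suc n))} {xs = cyclotomics≤ (suc n)} ∤p)
  (cyclotomics≤-prime pr n (ℕₚ.<-trans (ℕₚ.n<1+n (suc n)) lt))
  where
  ∤p : ¬ suc (suc n) ℕ∣.∣ p
  ∤p d with prime⇒irreducible pr d
  ... | inj₂ ≡p = ℕₚ.<⇒≢ lt ≡p

X-1 : ℤ[x].Poly
X-1 = ℤ[x].∏ₗ (cyclotomic 1 ∷ [])

cyclotomic-prime : ∀ {m} → Prime (suc (suc m)) → ∀ n →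
  ℤ[x].coeff (cyclotomic (suc (suc m))) n ≡ below-coeff (suc (suc m)) n
cyclotomic-prime {m} pr n = ≡.trans
  (cong (λ ds → ℤ[x].coeff
      ((ℤ[x].X ℤ[x].^ suc (suc m) ℤ[x].- ℤ[x].1#) ℤ[x]./ₘ ℤ[x].∏ₗ (map proj₂ ds)) n)
    (cyclotomics≤-prime pr m (ℕₚ.n<1+n _)))
  -- `X-1` evaluates to a list with head `-1` and degree 1, as the division lemmas require.
  (quotient-X^-1 {drop 1 X-1} refl (suc m)
    (ℤ[x].X ℤ[x].^ suc (suc m) ℤ[x].- ℤ[x].1#) (coeffℤ-X^-1 (suc m)) n)

coeff-reduce : ∀ f n → coeff (reduce f) n ≡ ℕ.parity ℤ.∣ ℤ[x].coeff f n ∣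
coeff-reduce []      n       = refl
coeff-reduce (a ∷ f) zero    = refl
coeff-reduce (a ∷ f) (suc n) = coeff-reduce f n

coeff-replicate : ∀ k n → coeff (replicate k 1ℙ) n ≡ ℕ.parity ℤ.∣ below-coeff k n ∣
coeff-replicate zero    n       = refl
coeff-replicate (suc k) zero    = refl
coeff-replicate (suc k) (suc n) = coeff-replicate k n

φ-prime : ∀ {m} → Prime (suc (suc m)) → φ (suc (suc m)) ≈ replicate (suc (suc m)) 1ℙ
φ-prime {m} pr = coeffwise λ n → ≡.trans (coeff-reduce (cyclotomic (suc (suc m))) n)
  (≡.trans (cong (λ z → ℕ.parity ℤ.∣ z ∣) (cyclotomic-prime pr n))
    (≡.sym (coeff-replicate (suc (suc m)) n)))

theorem1p1 : ∀ (p : ℕ) → Prime p → p ≥ 5 →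
    ∀ (M : 𝔽₂[x]) → MersennePrime M → M ∉ Σₚ p →
    (φ p ⟨ M ⟩ ≈ ∑ {p} (λ i → M ^ toℕ i)) ×
    (∑ {p} (λ i → M ^ toℕ i) ≈ σ (M ^ (p ∸ 1))) ×
    (∃ λ P → Irreducible P × ¬ MersennePrime P × P ∣ φ p ⟨ M ⟩)
theorem1p1 p@(suc (suc m)) pr p≥5 M mers M∉Σ =
  let k , p≡ = prime-odd pr p≥5
      P , irr , ¬mers , P∣G = geometric-hasNonMersenneFactor {p} {M} k p≡ mers M∉Σ
  in R.trans φ≈ (R.sym (∑-powers M p))
   , R.trans (∑-powers M p) (R.sym (σ-^ (proj₁ mers) (suc m)))
   , P , irr , ¬mers , ∣ʳ-respʳ-≈ (R.sym φ≈) P∣G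
  where
  φ≈ : φ p ⟨ M ⟩ ≈ geometric M p
  φ≈ = ⟨⟩-congˡ {φ p} {replicate p 1ℙ} M (φ-prime pr)
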